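{- For every $\epsilon>0$, Algorithm $A2$ (with its parameter chosen sufficiently small) is a $(\rho+\epsilon)$-approximation algorithm for $(2,4)$-uniform unweighted set cover, where $\rho\le\frac{35}{24}=1.458333\ldots$. That is, on every instance it returns a cover whose number of sets is at most $(\rho+\epsilon)$ times the minimum possible.
   Context: $(2,4)$-uniform unweighted set cover: given $n$ base elements and a finite collection of subsets of them, each of size $2$, $3$ or $4$, such that all subsets of size $2$ belong to the collection, find a subcollection of minimum cardinality covering all base elements. The collection is treated as subset-closed (every subset of an available set is also available), so feasible solutions are taken to consist of pairwise disjoint sets. For a feasible solution let $X_i$ be the number of its sets of size $i$ ($i$-sets). Algorithm $A2$ has a parameter $\delta\in(0,\frac1{100}]$ with $1/\delta$ an integer: 1. Start with an arbitrary feasible cover. 2. Perform a local search improvement step: remove up to $\frac1\delta$ of the $3$- and $4$-sets of the current solution and insert any number of available $3$- and $4$-sets (keeping the chosen $3$- and $4$-sets pairwise disjoint), so as to increase the objective $4X_4+X_3$. 3. Repeat step 2 until no local search improvement step exists. 4. Cover the remaining base elements (those not in the chosen $3$- and $4$-sets) with disjoint $2$-sets (and at most one smaller set if parity requires). -}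

module Defs where

open import Data.Nat using (ℕ; _+_; _*_; _≤_; _<_; _≤?_; _≟_)
open import Data.Integer using (+_)
import Data.Rational as ℚ
open ℚ using (ℚ)
open import Data.Fin.Subset using (Subset; Nonempty; Empty; _∩_; _∈_; _⊆_; ∣_∣)
open import Data.List using (List; _++_; length; filter)
open import Data.List.Membership.Propositional renaming (_∈_ to _∈ˡ_)
open import Data.List.Relation.Unary.All using (All)
open import Data.List.Relation.Unary.Any using (Any)
open import Data.List.Relation.Unary.AllPairs using (AllPairs)
open import Data.List.Relation.Binary.Permutation.Propositional using (_↭_)
open import Data.Product using (_×_; ∃-syntax)
open import Function using (flip)
open import Induction.WellFounded using (Acc)
open import Relation.Binary.Construct.Closure.ReflexiveTransitive using (Star)
open import Relation.Binary.PropositionalEquality using (_≡_)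
open import Relation.Nullary using (¬_)

record Instance (n : ℕ) : Set where
  field
    family : List (Subset n)
    sizes  : All (λ s → 2 ≤ ∣ s ∣ × ∣ s ∣ ≤ 4) family
    pairs  : ∀ s → ∣ s ∣ ≡ 2 → s ∈ˡ family

open Instance public

Covers : ∀ {n} → List (Subset n) → Set
Covers C = ∀ x → Any (x ∈_) C

Disjoint : ∀ {n} → Subset n → Subset n → Set
Disjoint s t = Empty (s ∩ t)

-- Covers in the original, non-closed family.  Sets may overlap; listing a set
-- twice only increases the length, so the minimum is that over subcollections.
IsCover : ∀ {n} → Instance n → List (Subset n) → Set
IsCover I C = All (_∈ˡ family I) C × Covers C

IsMinimumCover : ∀ {n} → Instance n → List (Subset n) → Set
IsMinimumCover I C = IsCover I C × (∀ D → IsCover I D → length C ≤ length D)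

-- The subset-closure of the family; this also contains 1-sets.
Available : ∀ {n} → Instance n → Subset n → Set
Available I s = Nonempty s × Any (s ⊆_) (family I)

Feasible : ∀ {n} → Instance n → List (Subset n) → Set
Feasible I C = All (Available I) C × AllPairs Disjoint C × Covers C

-- X i C is the number of i-sets in C.
X : ∀ {n} → ℕ → List (Subset n) → ℕ
X i C = length (filter (λ s → ∣ s ∣ ≟ i) C)

objective : ∀ {n} → List (Subset n) → ℕ
objective C = 4 * X 4 C + X 3 C

-- During the local search only the 3- and 4-sets matter: the smaller sets are
-- discarded and chosen anew once the search has stopped.
bigSets : ∀ {n} → List (Subset n) → List (Subset n)
bigSets = filter (λ s → 3 ≤? ∣ s ∣)

Packing : ∀ {n} → Instance n → List (Subset n) → Set
Packing I P =
  All (λ s → Available I s × 3 ≤ ∣ s ∣ × ∣ s ∣ ≤ 4) P × AllPairs Disjoint P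

-- The argument k is 1/δ.  Lists of sets are read up to reordering.
Improvement : ∀ {n} → Instance n → ℕ → List (Subset n) → List (Subset n) → Set
Improvement I k P Q =
  ∃[ kept ] ∃[ removed ] ∃[ inserted ]
    P ↭ removed ++ kept × length removed ≤ k ×
    Q ↭ inserted ++ kept × Packing I Q ×
    objective P < objective Q

LocalOptimum : ∀ {n} → Instance n → ℕ → List (Subset n) → Set
LocalOptimum I k P = ∀ Q → ¬ Improvement I k P Q

-- Since the sets of C partition the base elements, the 1-set is present
-- exactly when the number of elements outside P is odd.
Completes : ∀ {n} → List (Subset n) → List (Subset n) → Set
Completes P C =
  ∃[ twos ] ∃[ ones ]
    C ≡ P ++ twos ++ ones ×
    All (λ s → ∣ s ∣ ≡ 2) twos ×
    All (λ s → ∣ s ∣ ≡ 1) ones × length ones ≤ 1 ×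
    AllPairs Disjoint C × Covers C

-- The algorithm with δ = 1/k is nondeterministic: A2Returns I k S C says that
-- some run from the initial feasible cover S ends with the cover C.
A2Returns : ∀ {n} → Instance n → ℕ → List (Subset n) → List (Subset n) → Set
A2Returns I k S C =
  ∃[ P ] Star (Improvement I k) (bigSets S) P × LocalOptimum I k P × Completes P C

-- Accessibility says that no run of the local search is infinite.
A2Terminates : ∀ {n} → Instance n → ℕ → List (Subset n) → Set
A2Terminates I k S =
  Acc (flip (Improvement I k)) (bigSets S) × (∃[ C ] A2Returns I k S C)

fromℕ : ℕ → ℚ
fromℕ m = + m ℚ./ 1

A2IsApproximation : ℕ → ℚ → Set
A2IsApproximation k r =
  ∀ n (I : Instance n) S → Feasible I S →
    A2Terminates I k S ×
    (∀ C → A2Returns I k S C →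
      Feasible I C ×
      (∀ O → IsMinimumCover I O → fromℕ (length C) ℚ.≤ r ℚ.* fromℕ (length O)))

{-# OPTIONS --safe #-}

-- Let P be the 3- and 4-sets at the end of the search and D a minimum cover made
-- disjoint.  The elements covered by P are given values such that a 4-set of P
-- carries at most 48, a 3-set of P at most 24, while a 4-set of D collects at
-- least 26 and a 3-set of D at least 2; double counting then yields
-- 24 |C| ≤ 35 |D| + 12.  The values 10 (in a 4-set of P) and 8 (in a 3-set)
-- suffice, except for the 4-sets of D meeting P in only two elements, which lie
-- in two 4-sets (AA) or in a 4-set and a 3-set (AB).  Regard these as edges of a
-- graph on P.  Exchanging all edges at up to four 4-sets, and keeping every
-- remainder of size 3 of a destroyed set, bounds the amount of branching and of AB
-- edges in every small connected part, so that the shortage can be shifted along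
-- AA edges.  The 12 is due to the possible 1-set.  It is absorbed by ε if P has
-- more than k sets; otherwise P maximises the objective, which leaves room for it.
module Submission where

open import Defs
open import Data.Bool using (true; false; if_then_else_) renaming (_≟_ to _≟ᵇ_)
open import Data.Empty using (⊥-elim)
open import Data.Fin using (Fin; zero; suc) renaming (_≟_ to _≟ᶠ_)
open import Data.Fin.Properties using (any?)
open import Data.Fin.Subset hiding (_⊃_)
open import Data.Fin.Subset.Properties
open import Data.List using (List; []; _∷_; _++_; length; filter; map; allFin)
open import Data.List.Properties using (length-++; length-filter)
open import Data.List.Membership.Propositional using () renaming (_∈_ to _∈ˡ_)
open import Data.List.Membership.Propositional.Properties using (∈-filter⁺; ∈-filter⁻; ∈-map⁻; ∈-∃++; ∈-allFin)
open import Data.List.Relation.Binary.Permutation.Propositional as ↭ using (_↭_; ↭-sym; ↭-trans; ↭-refl)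
open import Data.List.Relation.Binary.Permutation.Propositional.Properties using (↭-length; shift; drop-∷; ∈-resp-↭)
open import Data.List.Relation.Unary.All as All using (All; []; _∷_)
import Data.List.Relation.Unary.All.Properties as Allₚ
open import Data.List.Relation.Unary.AllPairs as AllPairs using (AllPairs; []; _∷_)
import Data.List.Relation.Unary.AllPairs.Properties as AllPairsₚ
open import Data.List.Relation.Unary.Any as Any using (Any; here; there)
open import Data.List.Relation.Unary.Unique.Propositional.Properties using (allFin⁺)
open import Data.Nat hiding (_/_)
open import Data.Nat.Properties
open import Data.Nat.Tactic.RingSolver using (solve-∀)
open import Data.Product using (_×_; _,_; proj₁; proj₂; ∃-syntax; ∃₂)
open import Data.Sum using (_⊎_; inj₁; inj₂; [_,_]′)
open import Data.Vec using ([]; _∷_; here; there)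
open import Data.Vec.Properties using (≡-dec)
open import Function using (_∘_; flip; id; case_of_)
open import Induction.WellFounded using (Acc; acc)
open import Relation.Binary.Construct.Closure.ReflexiveTransitive using (Star; _◅_) renaming (ε to stay)
open import Relation.Binary.Definitions using (DecidableEquality)
open import Relation.Binary.PropositionalEquality
open import Relation.Nullary
open import Relation.Nullary.Decidable using (map′)
open import Relation.Unary using (Decidable)
open import Algebra.Properties.Semiring.Sum +-*-semiring using (sum-cong-≗; ∑-distrib-+; *-distribˡ-sum; sum-replicate-zero) renaming (sum to ∑)

-- The numbers come from the target `35 / 24`. With 70 = 2 * 35, a 4-set of `D` has to collect 4 *
-- 24 - 70 = 26 and a 3-set 3 * 24 - 70 = 2. Inserting a single set of `D` costs 3 for an element
-- taken from a 4-set of `P`, as a 3-set of weight 1 survives, and 1 for an element taken from a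
-- 3-set. So a 4-set of `D` with i elements of the former and j of the latter kind satisfies 4 ≤ 3i
-- + j. Under the values 10 and 8 only (2, 0) and (1, 1) stay below 26, lacking 6 and 8. A 4-set of
-- `P` has a reserve of 48 - 40 = 8, a 3-set has none. Thus an AB edge takes the whole reserve of
-- its 4-set, and an AA edge asks for 3 at each end, which is too much for a 4-set with three AA
-- edges or with an AB and an AA edge. Single exchanges do not exclude these. Joint exchanges do,
-- because a 4-set that loses several elements costs 4 in all and not 3 for each. Four centres are
-- what it takes to rule out a path of AA edges Q, S, T, R in which both end sets also have AB
-- edges; on such a path S and T would both have to help out.

private variable
  n : ℕ
  A : Set

-- Sums and indicator functions

absurd : ∀ {a b : ℕ} {B : Set} → a ≤ b → b < a → B
absurd a≤b b<a = ⊥-elim (<⇒≱ b<a a≤b)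

-- Turns linear arithmetic into a ring identity: `a ≤ b` is the sum of the hypotheses with their
-- multipliers, and `solve-∀` checks the rest.
≤-from : ∀ {a b l r} → a ≤ b → l + b ≡ r + a → l ≤ r
≤-from {a} {b} {l} {r} a≤b eq = +-cancelʳ-≤ b l r (≤-trans (≤-reflexive eq) (+-monoʳ-≤ r a≤b))

𝟙 : {P : Set} → Dec P → ℕ
𝟙 d = if does d then 1 else 0

𝟙-yes : {P : Set} (d : Dec P) → P → 𝟙 d ≡ 1
𝟙-yes (yes _) _ = refl
𝟙-yes (no ¬p) p = contradiction p ¬p

𝟙-no : {P : Set} (d : Dec P) → ¬ P → 𝟙 d ≡ 0
𝟙-no (yes p) ¬p = contradiction p ¬p
𝟙-no (no _) _ = refl

𝟙≤1 : {P : Set} (d : Dec P) → 𝟙 d ≤ 1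
𝟙≤1 (yes _) = ≤-refl
𝟙≤1 (no _) = z≤n

∑-mono : {f g : Fin n → ℕ} → (∀ v → f v ≤ g v) → ∑ f ≤ ∑ g
∑-mono {zero} _ = z≤n
∑-mono {suc _} f≤g = +-mono-≤ (f≤g zero) (∑-mono (f≤g ∘ suc))

∑-zero : {f : Fin n → ℕ} → (∀ v → f v ≡ 0) → ∑ f ≡ 0
∑-zero {n} f≡0 = trans (sum-cong-≗ f≡0) (sum-replicate-zero n)

∑-point : (f : Fin n → ℕ) (v : Fin n) → f v ≤ ∑ f
∑-point f zero = m≤m+n _ _
∑-point f (suc v) = ≤-trans (∑-point (f ∘ suc) v) (m≤n+m _ _)

∑-two : (f : Fin n → ℕ) {v u : Fin n} → v ≢ u → f v + f u ≤ ∑ f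
∑-two f {zero} {zero} v≢u = contradiction refl v≢u
∑-two f {zero} {suc u} _ = +-monoʳ-≤ _ (∑-point (f ∘ suc) u)
∑-two f {suc v} {zero} _ = ≤-trans (≤-reflexive (+-comm (f (suc v)) _)) (+-monoʳ-≤ _ (∑-point (f ∘ suc) v))
∑-two f {suc v} {suc u} v≢u = ≤-trans (∑-two (f ∘ suc) (v≢u ∘ cong suc)) (m≤n+m _ _)

∑-three : (f : Fin n → ℕ) {v u x : Fin n} → v ≢ u → v ≢ x → u ≢ x → f v + f u + f x ≤ ∑ f
∑-three f {zero} {zero} v≢u _ _ = contradiction refl v≢u
∑-three f {zero} {_} {zero} _ v≢x _ = contradiction refl v≢x
∑-three f {_} {zero} {zero} _ _ u≢x = contradiction refl u≢x
∑-three f {zero} {suc u} {suc x} _ _ u≢x =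
  ≤-trans (≤-reflexive (+-assoc (f zero) _ _)) (+-monoʳ-≤ _ (∑-two (f ∘ suc) (u≢x ∘ cong suc)))
∑-three f {suc v} {zero} {suc x} _ v≢x _ =
  ≤-trans (≤-reflexive (lemma (f (suc v)) (f zero) (f (suc x)))) (+-monoʳ-≤ _ (∑-two (f ∘ suc) (v≢x ∘ cong suc)))
  where lemma : ∀ a b c → a + b + c ≡ b + (a + c)
        lemma = solve-∀
∑-three f {suc v} {suc u} {zero} v≢u _ _ =
  ≤-trans (≤-reflexive (+-comm _ (f zero))) (+-monoʳ-≤ _ (∑-two (f ∘ suc) (v≢u ∘ cong suc)))
∑-three f {suc v} {suc u} {suc x} v≢u v≢x u≢x =
  ≤-trans (∑-three (f ∘ suc) (v≢u ∘ cong suc) (v≢x ∘ cong suc) (u≢x ∘ cong suc)) (m≤n+m _ _)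

∑-supp₁ : (f : Fin n → ℕ) (v : Fin n) → (∀ x → x ≢ v → f x ≡ 0) → ∑ f ≡ f v
∑-supp₁ f zero off = trans (cong (f zero +_) (∑-zero (λ x → off (suc x) λ ()))) (+-identityʳ _)
∑-supp₁ f (suc v) off = cong₂ _+_ (off zero λ ()) (∑-supp₁ (f ∘ suc) v (λ x x≢v → off (suc x) (λ { refl → x≢v refl })))

∑-supp₂ : (f : Fin n → ℕ) {v u : Fin n} → v ≢ u → (∀ x → x ≢ v → x ≢ u → f x ≡ 0) → ∑ f ≡ f v + f u
∑-supp₂ f {zero} {zero} v≢u _ = contradiction refl v≢u
∑-supp₂ f {zero} {suc u} _ off =
  cong (f zero +_) (∑-supp₁ (f ∘ suc) u (λ x x≢u → off (suc x) (λ ()) (λ { refl → x≢u refl })))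
∑-supp₂ f {suc v} {zero} _ off =
  trans (cong (f zero +_) (∑-supp₁ (f ∘ suc) v (λ x x≢v → off (suc x) (λ { refl → x≢v refl }) (λ ())))) (+-comm (f zero) _)
∑-supp₂ f {suc v} {suc u} v≢u off = cong₂ _+_ (off zero (λ ()) (λ ()))
  (∑-supp₂ (f ∘ suc) (v≢u ∘ cong suc) (λ x x≢v x≢u → off (suc x) (λ { refl → x≢v refl }) (λ { refl → x≢u refl })))

∑ₗ : (A → ℕ) → List A → ℕ
∑ₗ f [] = 0
∑ₗ f (x ∷ xs) = f x + ∑ₗ f xs

∑ₗ-mono : {f g : A → ℕ} (xs : List A) → (∀ {x} → x ∈ˡ xs → f x ≤ g x) → ∑ₗ f xs ≤ ∑ₗ g xs
∑ₗ-mono [] _ = z≤n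
∑ₗ-mono (x ∷ xs) f≤g = +-mono-≤ (f≤g (here refl)) (∑ₗ-mono xs (f≤g ∘ there))

∑ₗ-cong : {f g : A → ℕ} (xs : List A) → (∀ {x} → x ∈ˡ xs → f x ≡ g x) → ∑ₗ f xs ≡ ∑ₗ g xs
∑ₗ-cong [] _ = refl
∑ₗ-cong (x ∷ xs) f≡g = cong₂ _+_ (f≡g (here refl)) (∑ₗ-cong xs (f≡g ∘ there))

∑ₗ-zero : {f : A → ℕ} (xs : List A) → (∀ {x} → x ∈ˡ xs → f x ≡ 0) → ∑ₗ f xs ≡ 0
∑ₗ-zero [] _ = refl
∑ₗ-zero (x ∷ xs) f≡0 = cong₂ _+_ (f≡0 (here refl)) (∑ₗ-zero xs (f≡0 ∘ there))

∑ₗ-distrib-+ : (f g : A → ℕ) (xs : List A) → ∑ₗ (λ x → f x + g x) xs ≡ ∑ₗ f xs + ∑ₗ g xs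
∑ₗ-distrib-+ f g [] = refl
∑ₗ-distrib-+ f g (x ∷ xs) = trans (cong (f x + g x +_) (∑ₗ-distrib-+ f g xs)) (lemma (f x) (g x) (∑ₗ f xs) (∑ₗ g xs))
  where lemma : ∀ a b c d → a + b + (c + d) ≡ a + c + (b + d)
        lemma = solve-∀

∑ₗ-distribˡ-* : (c : ℕ) (f : A → ℕ) (xs : List A) → ∑ₗ (λ x → c * f x) xs ≡ c * ∑ₗ f xs
∑ₗ-distribˡ-* c f [] = sym (*-zeroʳ c)
∑ₗ-distribˡ-* c f (x ∷ xs) = trans (cong (c * f x +_) (∑ₗ-distribˡ-* c f xs)) (sym (*-distribˡ-+ c (f x) _))

∑ₗ-const : (c : ℕ) (xs : List A) → ∑ₗ (λ _ → c) xs ≡ length xs * c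
∑ₗ-const c [] = refl
∑ₗ-const c (x ∷ xs) = cong (c +_) (∑ₗ-const c xs)

∑ₗ-++ : (f : A → ℕ) (xs ys : List A) → ∑ₗ f (xs ++ ys) ≡ ∑ₗ f xs + ∑ₗ f ys
∑ₗ-++ f [] ys = refl
∑ₗ-++ f (x ∷ xs) ys = trans (cong (f x +_) (∑ₗ-++ f xs ys)) (sym (+-assoc (f x) _ _))

∑ₗ-↭ : (f : A → ℕ) {xs ys : List A} → xs ↭ ys → ∑ₗ f xs ≡ ∑ₗ f ys
∑ₗ-↭ f ↭.refl = refl
∑ₗ-↭ f (↭.prep x p) = cong (f x +_) (∑ₗ-↭ f p)
∑ₗ-↭ f (↭.swap x y p) = trans (lemma (f x) (f y) _) (cong (λ s → f y + (f x + s)) (∑ₗ-↭ f p))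
  where lemma : ∀ a b c → a + (b + c) ≡ b + (a + c)
        lemma = solve-∀
∑ₗ-↭ f (↭.trans p q) = trans (∑ₗ-↭ f p) (∑ₗ-↭ f q)

∑ₗ-member : (f : A → ℕ) {x : A} {xs : List A} → x ∈ˡ xs → f x ≤ ∑ₗ f xs
∑ₗ-member f (here refl) = m≤m+n _ _
∑ₗ-member f (there x∈xs) = ≤-trans (∑ₗ-member f x∈xs) (m≤n+m _ _)

∑ₗ-∑-comm : (f : A → Fin n → ℕ) (xs : List A) → ∑ₗ (λ x → ∑ (f x)) xs ≡ ∑ (λ v → ∑ₗ (λ x → f x v) xs)
∑ₗ-∑-comm {n = n} f [] = sym (sum-replicate-zero n)
∑ₗ-∑-comm f (x ∷ xs) = trans (cong (∑ (f x) +_) (∑ₗ-∑-comm f xs)) (sym (∑-distrib-+ (f x) _))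

∑ₗ-filter : {P : A → Set} (P? : Decidable P) (f : A → ℕ) (xs : List A) →
            ∑ₗ f xs ≡ ∑ₗ f (filter P? xs) + ∑ₗ f (filter (¬? ∘ P?) xs)
∑ₗ-filter P? f [] = refl
∑ₗ-filter P? f (x ∷ xs) with P? x
... | yes _ = trans (cong (f x +_) (∑ₗ-filter P? f xs)) (sym (+-assoc (f x) _ _))
... | no _ = trans (cong (f x +_) (∑ₗ-filter P? f xs)) (lemma (f x) (∑ₗ f (filter P? xs)) _)
  where lemma : ∀ a b c → a + (b + c) ≡ b + (a + c)
        lemma = solve-∀

filter-↭-split : {P : A → Set} (P? : Decidable P) (xs : List A) → xs ↭ filter P? xs ++ filter (¬? ∘ P?) xs
filter-↭-split P? [] = ↭-refl
filter-↭-split P? (x ∷ xs) with P? x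
... | yes _ = ↭.prep x (filter-↭-split P? xs)
... | no _ = ↭-trans (↭.prep x (filter-↭-split P? xs)) (↭-sym (shift x (filter P? xs) _))

-- Indicator functions of subsets and multiplicities in lists of subsets

χ : Subset n → Fin n → ℕ
χ S v = 𝟙 (v ∈? S)

χ-in : {S : Subset n} {v : Fin n} → v ∈ S → χ S v ≡ 1
χ-in {S = S} {v} = 𝟙-yes (v ∈? S)

χ-out : {S : Subset n} {v : Fin n} → v ∉ S → χ S v ≡ 0
χ-out {S = S} {v} = 𝟙-no (v ∈? S)

χ≤1 : (S : Subset n) (v : Fin n) → χ S v ≤ 1
χ≤1 S v = 𝟙≤1 (v ∈? S)

∣∣≡∑χ : (S : Subset n) → ∣ S ∣ ≡ ∑ (χ S)
∣∣≡∑χ [] = refl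
∣∣≡∑χ (true ∷ S) = cong suc (∣∣≡∑χ S)
∣∣≡∑χ (false ∷ S) = ∣∣≡∑χ S

∑χ-mono : (S : Subset n) {f g : Fin n → ℕ} → (∀ v → v ∈ S → f v ≤ g v) →
          ∑ (λ v → χ S v * f v) ≤ ∑ (λ v → χ S v * g v)
∑χ-mono S {f} {g} f≤g = ∑-mono pointwise
  where pointwise : ∀ v → χ S v * f v ≤ χ S v * g v
        pointwise v with v ∈? S
        ... | yes v∈S = +-monoˡ-≤ 0 (f≤g v v∈S)
        ... | no _ = z≤n

∑χ-cong : (S : Subset n) {f g : Fin n → ℕ} → (∀ v → v ∈ S → f v ≡ g v) →
          ∑ (λ v → χ S v * f v) ≡ ∑ (λ v → χ S v * g v)
∑χ-cong S f≡g = ≤-antisym (∑χ-mono S (λ v v∈S → ≤-reflexive (f≡g v v∈S)))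
                          (∑χ-mono S (λ v v∈S → ≤-reflexive (sym (f≡g v v∈S))))

∑χ-const : (S : Subset n) (c : ℕ) → ∑ (λ v → χ S v * c) ≡ c * ∣ S ∣
∑χ-const S c = trans (sum-cong-≗ (λ v → *-comm (χ S v) c))
  (trans (sym (*-distribˡ-sum c (χ S))) (cong (c *_) (sym (∣∣≡∑χ S))))

∑χ-distrib-+ : (S : Subset n) (f g : Fin n → ℕ) →
               ∑ (λ v → χ S v * (f v + g v)) ≡ ∑ (λ v → χ S v * f v) + ∑ (λ v → χ S v * g v)
∑χ-distrib-+ S f g = trans (sum-cong-≗ (λ v → *-distribˡ-+ (χ S v) (f v) (g v))) (∑-distrib-+ (λ v → χ S v * f v) _)

∑χ-distribˡ-* : (S : Subset n) (c : ℕ) (f : Fin n → ℕ) →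
               ∑ (λ v → χ S v * (c * f v)) ≡ c * ∑ (λ v → χ S v * f v)
∑χ-distribˡ-* S c f = trans (sum-cong-≗ (λ v → lemma (χ S v) c (f v))) (sym (*-distribˡ-sum c (λ v → χ S v * f v)))
  where lemma : ∀ a b d → a * (b * d) ≡ b * (a * d)
        lemma = solve-∀

cnt : List (Subset n) → Fin n → ℕ
cnt C v = ∑ₗ (λ S → χ S v) C

∑ₗ-∑χ : (C : List (Subset n)) (f : Fin n → ℕ) →
        ∑ₗ (λ S → ∑ (λ v → χ S v * f v)) C ≡ ∑ (λ v → cnt C v * f v)
∑ₗ-∑χ C f = trans (∑ₗ-∑-comm (λ S v → χ S v * f v) C) (sum-cong-≗ (λ v → distrib v C))
  where distrib : ∀ v C → ∑ₗ (λ S → χ S v * f v) C ≡ cnt C v * f v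
        distrib v [] = refl
        distrib v (S ∷ C) = trans (cong (χ S v * f v +_) (distrib v C)) (sym (*-distribʳ-+ (f v) (χ S v) _))

cnt>0⇒∈ : (C : List (Subset n)) (v : Fin n) → 0 < cnt C v → ∃[ S ] S ∈ˡ C × v ∈ S
cnt>0⇒∈ (S ∷ C) v 0<c with v ∈? S
... | yes v∈S = S , here refl , v∈S
... | no _ = let T , T∈C , v∈T = cnt>0⇒∈ C v 0<c in T , there T∈C , v∈T

∈⇒cnt>0 : {C : List (Subset n)} {S : Subset n} {v : Fin n} → S ∈ˡ C → v ∈ S → 0 < cnt C v
∈⇒cnt>0 {C = C} {v = v} S∈C v∈S = ≤-trans (≤-reflexive (sym (χ-in v∈S))) (∑ₗ-member (λ S → χ S v) S∈C)

-- Disjointness as a bound on multiplicities, the form in which double counting uses it and in which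
-- it passes to sublists.
record Packed {n} (C : List (Subset n)) : Set where
  constructor packed
  field atMostOnce : ∀ v → cnt C v ≤ 1

open Packed

disjoint⇒packed : {C : List (Subset n)} → AllPairs Disjoint C → Packed C
disjoint⇒packed [] .atMostOnce v = z≤n
disjoint⇒packed {C = S ∷ C} (S#C ∷ C#) .atMostOnce v with v ∈? S
... | no _ = disjoint⇒packed C# .atMostOnce v
... | yes v∈S = s≤s (≮⇒≥ λ 0<c → let T , T∈C , v∈T = cnt>0⇒∈ C v 0<c in
                                 All.lookup S#C T∈C (v , x∈p∩q⁺ (v∈S , v∈T)))

packed-tail : {S : Subset n} {C : List (Subset n)} → Packed (S ∷ C) → Packed C
packed-tail pk .atMostOnce v = ≤-trans (m≤n+m _ _) (pk .atMostOnce v)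

packed⇒disjoint : {C : List (Subset n)} → Packed C → AllPairs Disjoint C
packed⇒disjoint {C = []} _ = []
packed⇒disjoint {C = S ∷ C} pk = All.tabulate apart ∷ packed⇒disjoint (packed-tail pk)
  where apart : ∀ {T} → T ∈ˡ C → Disjoint S T
        apart T∈C (v , v∈S∩T) = let v∈S , v∈T = x∈p∩q⁻ S _ v∈S∩T in
          absurd (pk .atMostOnce v) (+-mono-≤ (≤-reflexive (sym (χ-in v∈S))) (∈⇒cnt>0 T∈C v∈T))

packed-unique : {C : List (Subset n)} → Packed C → ∀ {S T v} → S ∈ˡ C → T ∈ˡ C → v ∈ S → v ∈ T → S ≡ T
packed-unique pk (here refl) (here refl) _ _ = refl
packed-unique pk {v = v} (here refl) (there T∈C) v∈S v∈T =
  absurd (pk .atMostOnce v) (+-mono-≤ (≤-reflexive (sym (χ-in v∈S))) (∈⇒cnt>0 T∈C v∈T))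
packed-unique pk {v = v} (there S∈C) (here refl) v∈S v∈T =
  absurd (pk .atMostOnce v) (+-mono-≤ (≤-reflexive (sym (χ-in v∈T))) (∈⇒cnt>0 S∈C v∈S))
packed-unique pk (there S∈C) (there T∈C) = packed-unique (packed-tail pk) S∈C T∈C

χ-∪ʳ : {S U : Subset n} {v : Fin n} → v ∉ S → χ (S ∪ U) v ≡ χ U v
χ-∪ʳ {S = S} {U} {v} v∉S with v ∈? U
... | yes v∈U = χ-in {S = S ∪ U} (x∈p∪q⁺ (inj₂ v∈U))
... | no v∉U = χ-out {S = S ∪ U} ([ v∉S , v∉U ]′ ∘ x∈p∪q⁻ S U)

χ-⋃ : {C : List (Subset n)} → Packed C → ∀ v → χ (⋃ C) v ≡ cnt C v
χ-⋃ {C = []} _ v = χ-out {S = ⊥} {v} ∉⊥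
χ-⋃ {C = S ∷ C} pk v = case v ∈? S of λ where
  (yes v∈S) → trans (χ-in {S = S ∪ ⋃ C} (x∈p∪q⁺ (inj₁ v∈S)))
    (≤-antisym (∈⇒cnt>0 {C = S ∷ C} (here refl) v∈S) (pk .atMostOnce v))
  (no v∉S) → trans (χ-∪ʳ {S = S} v∉S) (trans (χ-⋃ (packed-tail pk) v)
    (cong (_+ cnt C v) (sym (χ-out v∉S))))

∑ₗ-∣∣ : (C : List (Subset n)) → ∑ₗ ∣_∣ C ≡ ∑ (cnt C)
∑ₗ-∣∣ C = trans (∑ₗ-cong C (λ {S} _ → ∣∣≡∑χ S)) (∑ₗ-∑-comm χ C)

∑-one : ∀ n → ∑ {n} (λ _ → 1) ≡ n
∑-one zero = refl
∑-one (suc n) = cong suc (∑-one n)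

packed-size : {C : List (Subset n)} → Packed C → ∑ₗ ∣_∣ C ≤ n
packed-size {n} {C} pk = ≤-trans (≤-reflexive (∑ₗ-∣∣ C)) (≤-trans (∑-mono (pk .atMostOnce)) (≤-reflexive (∑-one n)))

partition-size : {C : List (Subset n)} → (∀ v → cnt C v ≡ 1) → ∑ₗ ∣_∣ C ≡ n
partition-size {n} {C} once = trans (∑ₗ-∣∣ C) (trans (sum-cong-≗ once) (∑-one n))

∑-exists : (f : Fin n → ℕ) → 0 < ∑ f → ∃[ v ] 0 < f v
∑-exists f 0<∑ with any? (λ v → 0 <? f v)
... | yes v,0<fv = v,0<fv
... | no none = absurd (≤-reflexive (∑-zero (λ v → n≤0⇒n≡0 (≮⇒≥ (none ∘ (v ,_)))))) 0<∑

∑≡1⇒point : (f : Fin n → ℕ) → ∑ f ≡ 1 → ∃[ v ] f v ≡ 1 × (∀ x → x ≢ v → f x ≡ 0)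
∑≡1⇒point f ∑≡1 with ∑-exists f (≤-reflexive (sym ∑≡1))
... | v , 0<fv = v , ≤-antisym (≤-trans (∑-point f v) (≤-reflexive ∑≡1)) 0<fv , λ x x≢v →
  n≤0⇒n≡0 (+-cancelˡ-≤ 1 _ _ (≤-trans (+-monoˡ-≤ (f x) 0<fv) (≤-trans (∑-two f (x≢v ∘ sym)) (≤-reflexive ∑≡1))))

∑≡2⇒points : (f : Fin n → ℕ) → (∀ v → f v ≤ 1) → ∑ f ≡ 2 →
             ∃₂ λ v u → v ≢ u × f v ≡ 1 × f u ≡ 1 × (∀ x → x ≢ v → x ≢ u → f x ≡ 0)
∑≡2⇒points f f≤1 ∑≡2 with ∑-exists f (≤-trans (s≤s z≤n) (≤-reflexive (sym ∑≡2)))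
... | v , 0<fv with any? (λ u → ¬? (u ≟ᶠ v) ×-dec 0 <? f u)
...   | no none = absurd (≤-trans (≤-reflexive (trans (sym ∑≡2) (∑-supp₁ f v λ x x≢v → n≤0⇒n≡0 (≮⇒≥ λ 0<fx → none (x , x≢v , 0<fx))))) (f≤1 v))
                         ≤-refl
...   | yes (u , u≢v , 0<fu) = v , u , u≢v ∘ sym , ≤-antisym (f≤1 v) 0<fv , ≤-antisym (f≤1 u) 0<fu , λ x x≢v x≢u →
  n≤0⇒n≡0 (+-cancelˡ-≤ 2 _ _ (≤-trans (+-monoˡ-≤ (f x) (+-mono-≤ 0<fv 0<fu))
    (≤-trans (∑-three f (u≢v ∘ sym) (x≢v ∘ sym) (x≢u ∘ sym)) (≤-reflexive ∑≡2))))

∑ₗ-comm : {A B : Set} (f : A → B → ℕ) (xs : List A) (ys : List B) →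
          ∑ₗ (λ x → ∑ₗ (f x) ys) xs ≡ ∑ₗ (λ y → ∑ₗ (λ x → f x y) xs) ys
∑ₗ-comm f [] ys = sym (∑ₗ-zero ys (λ _ → refl))
∑ₗ-comm f (x ∷ xs) ys = trans (cong (∑ₗ (f x) ys +_) (∑ₗ-comm f xs ys)) (sym (∑ₗ-distrib-+ (f x) _ ys))

∈─⇒∉ : (S U : Subset n) {v : Fin n} → v ∈ S ─ U → v ∉ U
∈─⇒∉ (_ ∷ S) (_ ∷ U) (there v∈) (there v∈U) = ∈─⇒∉ S U v∈ v∈U

χ-∩ : (S U : Subset n) (v : Fin n) → χ (S ∩ U) v ≡ χ S v * χ U v
χ-∩ S U v with v ∈? S | v ∈? U
... | yes v∈S | yes v∈U = χ-in {S = S ∩ U} (x∈p∩q⁺ (v∈S , v∈U))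
... | yes _ | no v∉U = χ-out {S = S ∩ U} (v∉U ∘ proj₂ ∘ x∈p∩q⁻ S U)
... | no v∉S | _ = χ-out {S = S ∩ U} (v∉S ∘ proj₁ ∘ x∈p∩q⁻ S U)

∣∩∣≡∑ : (S U : Subset n) → ∣ S ∩ U ∣ ≡ ∑ (λ v → χ S v * χ U v)
∣∩∣≡∑ S U = trans (∣∣≡∑χ (S ∩ U)) (sum-cong-≗ (χ-∩ S U))

∣─∣+∣∩∣ : (S U : Subset n) → ∣ S ─ U ∣ + ∣ S ∩ U ∣ ≡ ∣ S ∣
∣─∣+∣∩∣ [] [] = refl
∣─∣+∣∩∣ (true ∷ S) (true ∷ U) = trans (+-suc _ _) (cong suc (∣─∣+∣∩∣ S U))
∣─∣+∣∩∣ (true ∷ S) (false ∷ U) = cong suc (∣─∣+∣∩∣ S U)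
∣─∣+∣∩∣ (false ∷ S) (true ∷ U) = ∣─∣+∣∩∣ S U
∣─∣+∣∩∣ (false ∷ S) (false ∷ U) = ∣─∣+∣∩∣ S U

∣∣>0⇒nonempty : (S : Subset n) → 0 < ∣ S ∣ → Nonempty S
∣∣>0⇒nonempty S 0<s with nonempty? S
... | yes ne = ne
... | no empty = absurd (≤-trans (≤-reflexive (∣∣≡∑χ S))
                   (≤-reflexive (∑-zero (λ v → χ-out {S = S} (empty ∘ (v ,_)))))) 0<s

-- The exchange inequality

-- The contribution of a set of this size to `objective`. As it vanishes below 3, sums over `D` or
-- over remainders need no filter.
weight : ℕ → ℕ
weight m = 4 * 𝟙 (m ≟ 4) + 𝟙 (m ≟ 3)

weight≤ : ∀ m → weight m ≤ m
weight≤ 0 = z≤n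
weight≤ 1 = z≤n
weight≤ 2 = z≤n
weight≤ 3 = s≤s z≤n
weight≤ 4 = ≤-refl
weight≤ (suc (suc (suc (suc (suc m))))) = z≤n

length-filter≡∑ₗ : {A : Set} {P : A → Set} (P? : Decidable P) (xs : List A) → length (filter P? xs) ≡ ∑ₗ (λ x → 𝟙 (P? x)) xs
length-filter≡∑ₗ P? [] = refl
length-filter≡∑ₗ P? (x ∷ xs) with P? x
... | yes _ = cong suc (length-filter≡∑ₗ P? xs)
... | no _ = length-filter≡∑ₗ P? xs

X≡∑ₗ : ∀ i (C : List (Subset n)) → X i C ≡ ∑ₗ (λ s → 𝟙 (∣ s ∣ ≟ i)) C
X≡∑ₗ i = length-filter≡∑ₗ (λ s → ∣ s ∣ ≟ i)

objective≡∑ₗ : (C : List (Subset n)) → objective C ≡ ∑ₗ (λ s → weight ∣ s ∣) C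
objective≡∑ₗ C = sym (trans (∑ₗ-distrib-+ (λ s → 4 * 𝟙 (∣ s ∣ ≟ 4)) _ C)
  (cong₂ _+_ (trans (∑ₗ-distribˡ-* 4 _ C) (cong (4 *_) (sym (X≡∑ₗ 4 C)))) (sym (X≡∑ₗ 3 C))))

∑weight-filter : (C : List (Subset n)) →
                 ∑ₗ (λ s → weight ∣ s ∣) (filter (λ s → 3 ≤? ∣ s ∣) C) ≡ ∑ₗ (λ s → weight ∣ s ∣) C
∑weight-filter C = sym (trans (∑ₗ-filter (λ s → 3 ≤? ∣ s ∣) _ C)
  (trans (cong (∑ₗ _ (filter (λ s → 3 ≤? ∣ s ∣) C) +_) vanish) (+-identityʳ _)))
  where
  light : ∀ m → ¬ 3 ≤ m → weight m ≡ 0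
  light 0 _ = refl
  light 1 _ = refl
  light 2 _ = refl
  light (suc (suc (suc _))) 3≰m = contradiction (s≤s (s≤s (s≤s z≤n))) 3≰m
  vanish : ∑ₗ (λ s → weight ∣ s ∣) (filter (¬? ∘ (λ s → 3 ≤? ∣ s ∣)) C) ≡ 0
  vanish = ∑ₗ-zero _ (λ {s} s∈ → light ∣ s ∣ (proj₂ (∈-filter⁻ (¬? ∘ (λ s → 3 ≤? ∣ s ∣)) {xs = C} s∈)))

cnt≤0 : {C : List (Subset n)} {v : Fin n} → (∀ {S} → S ∈ˡ C → v ∉ S) → cnt C v ≤ 0
cnt≤0 {C = C} {v} none = ≮⇒≥ λ 0<c → let S , S∈C , v∈S = cnt>0⇒∈ C v 0<c in none S∈C v∈S

shrink-⊆ : {S T : Subset n} {F : List (Subset n)} → S ⊆ T → Any (T ⊆_) F → Any (S ⊆_) F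
shrink-⊆ S⊆T (here T⊆f) = here (λ v∈S → T⊆f (S⊆T v∈S))
shrink-⊆ S⊆T (there T⊆) = there (shrink-⊆ S⊆T T⊆)

touches? : (U S : Subset n) → Dec (Nonempty (S ∩ U))
touches? U S = nonempty? (S ∩ U)

module _ (I : Instance n) where

  packing⇒packed : {P : List (Subset n)} → Packing I P → Packed P
  packing⇒packed = disjoint⇒packed ∘ proj₂

  touched : List (Subset n) → List (Subset n) → List (Subset n)
  touched E P = filter (touches? (⋃ E)) P

  -- The sets of P that meet E are replaced by E together with the remainders,
  -- of size at least 3, of these sets outside E.
  exchange : ∀ {k P E} → LocalOptimum I k P → Packing I P → Packing I E → length (touched E P) ≤ k →
             ∑ₗ (λ s → weight ∣ s ∣) E + ∑ₗ (λ S → weight ∣ S ─ ⋃ E ∣) (touched E P)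
               ≤ ∑ₗ (λ s → weight ∣ s ∣) (touched E P)
  exchange {k} {P} {E} opt packP packE R≤k = conclude (≮⇒≥ (λ P<Q → opt Q (improves P<Q)))
    where
    U = ⋃ E
    R = touched E P
    kept = filter (¬? ∘ touches? U) P
    rest = map (_─ U) R
    big : List (Subset n) → List (Subset n)
    big = filter (λ s → 3 ≤? ∣ s ∣)
    Q = (E ++ big rest) ++ kept
    W : List (Subset n) → ℕ
    W = ∑ₗ (λ s → weight ∣ s ∣)

    R∈P : ∀ {S} → S ∈ˡ R → S ∈ˡ P
    R∈P S∈ = proj₁ (∈-filter⁻ (touches? U) {xs = P} S∈)
    rest⁻ : ∀ {T} → T ∈ˡ big rest → ∃[ S ] S ∈ˡ R × T ≡ S ─ U
    rest⁻ T∈ = ∈-map⁻ (_─ U) (proj₁ (∈-filter⁻ (λ s → 3 ≤? ∣ s ∣) {xs = rest} T∈))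

    packedP : Packed P
    packedP = packing⇒packed packP

    cnt-rest : ∀ v → cnt (big rest) v ≤ cnt R v
    cnt-rest v = ≤-trans (≤-trans (m≤m+n _ _) (≤-reflexive (sym (∑ₗ-filter (λ s → 3 ≤? ∣ s ∣) (λ S → χ S v) rest)))) (go R)
      where
      go : ∀ C → cnt (map (_─ U) C) v ≤ cnt C v
      go [] = z≤n
      go (S ∷ C) = +-mono-≤ (shrink S) (go C)
        where
        shrink : ∀ S → χ (S ─ U) v ≤ χ S v
        shrink S with v ∈? (S ─ U)
        ... | no _ = z≤n
        ... | yes v∈ = ≤-reflexive (sym (χ-in (p─q⊆p S U v∈)))

    cnt-Q : ∀ v → cnt Q v ≡ cnt E v + cnt (big rest) v + cnt kept v
    cnt-Q v = trans (∑ₗ-++ (λ S → χ S v) (E ++ big rest) kept)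
                    (cong (_+ cnt kept v) (∑ₗ-++ (λ S → χ S v) E (big rest)))

    packedQ : Packed Q
    -- Inside `U` only `E` counts an element, since remainders avoid `U` and kept sets do not touch
    -- it. Outside `U`, remainders and kept sets count it at most as often as `P` does.
    packedQ .atMostOnce v = ≤-trans (≤-reflexive (cnt-Q v)) (case v ∈? U of λ where
      (yes v∈U) → +-mono-≤ (+-mono-≤ (packing⇒packed packE .atMostOnce v)
          (cnt≤0 {C = big rest} λ T∈ v∈T → case rest⁻ T∈ of λ { (S , _ , refl) → ∈─⇒∉ S U v∈T v∈U }))
        (cnt≤0 {C = kept} λ S∈ v∈S → proj₂ (∈-filter⁻ (¬? ∘ touches? U) {xs = P} S∈) (v , x∈p∩q⁺ (v∈S , v∈U)))
      (no v∉U) → ≤-trans (+-monoˡ-≤ (cnt kept v) (+-mono-≤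
          (≤-reflexive (trans (sym (χ-⋃ (packing⇒packed packE) v)) (χ-out v∉U))) (cnt-rest v)))
        (≤-trans (≤-reflexive (sym (∑ₗ-filter (touches? U) (λ S → χ S v) P))) (packedP .atMostOnce v)))

    admissible : ∀ {T} → T ∈ˡ rest → 3 ≤ ∣ T ∣ → Available I T × 3 ≤ ∣ T ∣ × ∣ T ∣ ≤ 4
    admissible T∈ 3≤T with ∈-map⁻ (_─ U) T∈
    ... | S , S∈R , refl = let (_ , S⊆) , _ , S≤4 = All.lookup (proj₁ packP) (R∈P S∈R) in
      (∣∣>0⇒nonempty (S ─ U) (≤-trans (s≤s z≤n) 3≤T) , shrink-⊆ (p─q⊆p S U) S⊆) ,
      3≤T , ≤-trans (∣p─q∣≤∣p∣ S U) S≤4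

    packQ : Packing I Q
    packQ = Allₚ.++⁺ (Allₚ.++⁺ (proj₁ packE) (All.tabulate λ T∈ →
                let T∈rest , 3≤T = ∈-filter⁻ (λ s → 3 ≤? ∣ s ∣) {xs = rest} T∈ in admissible T∈rest 3≤T))
              (Allₚ.filter⁺ (¬? ∘ touches? U) (proj₁ packP))
          , packed⇒disjoint packedQ

    improves : objective P < objective Q → Improvement I k P Q
    improves P<Q = kept , R , E ++ big rest , filter-↭-split (touches? U) P , R≤k , ↭-refl , packQ , P<Q

    restW : W (big rest) ≡ ∑ₗ (λ S → weight ∣ S ─ U ∣) R
    restW = trans (∑weight-filter rest) (go R)
      where go : ∀ C → W (map (_─ U) C) ≡ ∑ₗ (λ S → weight ∣ S ─ U ∣) C
            go [] = refl
            go (S ∷ C) = cong (weight ∣ S ─ U ∣ +_) (go C)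

    conclude : objective Q ≤ objective P → W E + ∑ₗ (λ S → weight ∣ S ─ U ∣) R ≤ W R
    conclude Q≤P = +-cancelʳ-≤ (W kept) _ _ (begin
      W E + ∑ₗ (λ S → weight ∣ S ─ U ∣) R + W kept ≡⟨ cong (λ r → W E + r + W kept) restW ⟨
      W E + W (big rest) + W kept  ≡⟨ cong (_+ W kept) (∑ₗ-++ _ E (big rest)) ⟨
      W (E ++ big rest) + W kept   ≡⟨ ∑ₗ-++ _ (E ++ big rest) kept ⟨
      W Q                          ≡⟨ objective≡∑ₗ Q ⟨
      objective Q                  ≤⟨ Q≤P ⟩
      objective P                  ≡⟨ objective≡∑ₗ P ⟩
      W P                          ≡⟨ ∑ₗ-filter (touches? U) _ P ⟩
      W R + W kept                 ∎)
      where open ≤-Reasoning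

-- Runs of the algorithm

_≟ˢ_ : DecidableEquality (Subset n)
_≟ˢ_ = ≡-dec _≟ᵇ_

module _ {A : Set} (_≟ᴬ_ : DecidableEquality A) where
  open import Data.List.Membership.DecPropositional _≟ᴬ_ using () renaming (_∈?_ to _∈ˡ?_)

  _↭?_ : (xs ys : List A) → Dec (xs ↭ ys)
  [] ↭? [] = yes ↭-refl
  [] ↭? (y ∷ ys) = no λ p → case ↭-length p of λ ()
  (x ∷ xs) ↭? ys = case x ∈ˡ? ys of λ where
    (no x∉ys) → no λ p → x∉ys (∈-resp-↭ p (here refl))
    (yes x∈ys) → case ∈-∃++ x∈ys of λ { (as , bs , refl) →
      map′ (λ p → ↭-trans (↭.prep x p) (↭-sym (shift x as bs)))
           (λ p → drop-∷ (↭-trans p (shift x as bs)))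
           (xs ↭? (as ++ bs)) }

boundedList? : {Q : List (Subset n) → Set} → Decidable Q → ∀ m → Dec (∃[ C ] length C ≤ m × Q C)
boundedList? Q? zero = map′ (λ q → [] , z≤n , q) (λ { ([] , _ , q) → q }) (Q? [])
boundedList? Q? (suc m) = map′
  [ (λ q → [] , z≤n , q) , (λ { (S , C , C≤m , q) → S ∷ C , s≤s C≤m , q }) ]′
  (λ { ([] , _ , q) → inj₁ q ; (S ∷ C , s≤s C≤m , q) → inj₂ (S , C , C≤m , q) })
  (Q? [] ⊎-dec anySubset? (λ S → boundedList? (λ C → Q? (S ∷ C)) m))

module _ (I : Instance n) where

  available? : Decidable (Available I)
  available? S = nonempty? S ×-dec Any.any? (S ⊆?_) (family I)

  packing? : Decidable (Packing I)
  packing? C = All.all? (λ S → available? S ×-dec (3 ≤? ∣ S ∣ ×-dec ∣ S ∣ ≤? 4)) C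
    ×-dec AllPairs.allPairs? (λ S T → ¬? (nonempty? (S ∩ T))) C

  available⇒≤4 : ∀ {S} → Available I S → ∣ S ∣ ≤ 4
  available⇒≤4 (_ , S⊆) = go (sizes I) S⊆
    where go : ∀ {S F} → All (λ s → 2 ≤ ∣ s ∣ × ∣ s ∣ ≤ 4) F → Any (S ⊆_) F → ∣ S ∣ ≤ 4
          go ((_ , f≤4) ∷ _) (here S⊆f) = ≤-trans (p⊆q⇒∣p∣≤∣q∣ S⊆f) f≤4
          go (_ ∷ szs) (there S⊆) = go szs S⊆

  packing-length : ∀ {P} → Packing I P → length P ≤ n
  packing-length {P} packP = begin
    length P          ≡⟨ *-identityʳ (length P) ⟨
    length P * 1      ≡⟨ ∑ₗ-const 1 P ⟨
    ∑ₗ (λ _ → 1) P    ≤⟨ ∑ₗ-mono P (λ S∈P → ≤-trans (s≤s z≤n) (proj₁ (proj₂ (All.lookup (proj₁ packP) S∈P)))) ⟩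
    ∑ₗ ∣_∣ P          ≤⟨ packed-size (packing⇒packed I packP) ⟩
    n                 ∎
    where open ≤-Reasoning

  packing-objective : ∀ {P} → Packing I P → objective P ≤ n
  packing-objective {P} packP = begin
    objective P                   ≡⟨ objective≡∑ₗ P ⟩
    ∑ₗ (λ S → weight ∣ S ∣) P     ≤⟨ ∑ₗ-mono P (λ {S} _ → weight≤ ∣ S ∣) ⟩
    ∑ₗ ∣_∣ P                      ≤⟨ packed-size (packing⇒packed I packP) ⟩
    n                             ∎
    where open ≤-Reasoning

  -- Exhaustive search: `kept` and `removed` are no longer than `P`, and the disjoint nonempty sets
  -- of `Q` bound its length, and that of `inserted`, by `n`.
  improvement? : ∀ k P → Dec (∃[ Q ] Improvement I k P Q)
  improvement? k P = map′
    (λ { (Q , _ , kept , _ , removed , _ , inserted , _ , imp) → Q , kept , removed , inserted , imp })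
    (λ { (Q , kept , removed , inserted , imp@(P↭ , _ , Q↭ , packQ , _)) →
      Q , packing-length packQ ,
      kept , ≤-trans (m≤n+m _ (length removed)) (≤-reflexive (trans (sym (length-++ removed)) (sym (↭-length P↭)))) ,
      removed , ≤-trans (m≤m+n _ (length kept)) (≤-reflexive (trans (sym (length-++ removed)) (sym (↭-length P↭)))) ,
      inserted , ≤-trans (≤-trans (m≤m+n _ (length kept)) (≤-reflexive (trans (sym (length-++ inserted)) (sym (↭-length Q↭)))))
                         (packing-length packQ) ,
      imp })
    (boundedList? (λ Q → boundedList? (λ kept → boundedList? (λ removed → boundedList? (λ inserted →
        _↭?_ _≟ˢ_ P (removed ++ kept) ×-dec (length removed ≤? k ×-dec (_↭?_ _≟ˢ_ Q (inserted ++ kept) ×-dec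
        (packing? Q ×-dec (objective P <? objective Q)))))
      n) (length P)) (length P)) n)

  -- The objective of a packing never exceeds `n` and each step raises it; `m` bounds the number of
  -- steps still possible.
  improvement-wf : ∀ k P → Acc (flip (Improvement I k)) P
  improvement-wf k P = go n P (m≤m+n n (objective P))
    where
    go : ∀ m P → n ≤ m + objective P → Acc (flip (Improvement I k)) P
    go zero P n≤ = acc λ { (_ , _ , _ , _ , _ , _ , packQ , P<Q) → absurd (≤-trans (packing-objective packQ) n≤) P<Q }
    go (suc m) P n≤ = acc λ { {Q} (_ , _ , _ , _ , _ , _ , _ , P<Q) →
      go m Q (≤-trans n≤ (≤-trans (≤-reflexive (sym (+-suc m _))) (+-monoʳ-≤ m P<Q))) }

  localSearch : ∀ k P → Acc (flip (Improvement I k)) P → ∃[ Q ] Star (Improvement I k) P Q × LocalOptimum I k Q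
  localSearch k P (acc rs) = case improvement? k P of λ where
    (no none) → P , stay , λ Q imp → none (Q , imp)
    (yes (Q , imp)) → let R , Q⇝R , opt = localSearch k Q (rs imp) in R , imp ◅ Q⇝R , opt

  search-packing : ∀ {k P Q} → Packing I P → Star (Improvement I k) P Q → Packing I Q
  search-packing packP stay = packP
  search-packing packP ((_ , _ , _ , _ , _ , _ , packQ , _) ◅ Q⇝R) = search-packing packQ Q⇝R

  bigSets-packing : ∀ {S} → Feasible I S → Packing I (bigSets S)
  bigSets-packing {S} (avail , S# , _) =
    All.tabulate (λ s∈ → let s∈S , 3≤s = ∈-filter⁻ (λ s → 3 ≤? ∣ s ∣) {xs = S} s∈ in
      All.lookup avail s∈S , 3≤s , available⇒≤4 (All.lookup avail s∈S)) ,
    filter-pairs S#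
    where
    filter-pairs : ∀ {C} → AllPairs Disjoint C → AllPairs Disjoint (bigSets C)
    filter-pairs = AllPairsₚ.filter⁺ (λ s → 3 ≤? ∣ s ∣)

-- Completing a packing by 2-sets

pairUp : List (Fin n) → List (Subset n) × List (Subset n)
pairUp [] = [] , []
pairUp (a ∷ []) = [] , ⁅ a ⁆ ∷ []
pairUp (a ∷ b ∷ us) = let twos , ones = pairUp us in (⁅ a ⁆ ∪ ⁅ b ⁆) ∷ twos , ones

occ : List (Fin n) → Fin n → ℕ
occ us v = cnt (map ⁅_⁆ us) v

∣pair∣ : {a b : Fin n} → a ≢ b → ∣ ⁅ a ⁆ ∪ ⁅ b ⁆ ∣ ≡ 2
∣pair∣ {a = a} {b} a≢b = trans (∣∣≡∑χ (⁅ a ⁆ ∪ ⁅ b ⁆))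
  (trans (∑-supp₂ _ a≢b (λ x x≢a x≢b → χ-out {S = ⁅ a ⁆ ∪ ⁅ b ⁆} ([ x≢a ∘ x∈⁅y⁆⇒x≡y a , x≢b ∘ x∈⁅y⁆⇒x≡y b ]′ ∘ x∈p∪q⁻ ⁅ a ⁆ ⁅ b ⁆)))
  (cong₂ _+_ (χ-in {S = ⁅ a ⁆ ∪ ⁅ b ⁆} (x∈p∪q⁺ (inj₁ (x∈⁅x⁆ a)))) (χ-in {S = ⁅ a ⁆ ∪ ⁅ b ⁆} (x∈p∪q⁺ {p = ⁅ a ⁆} (inj₂ (x∈⁅x⁆ b))))))

χ-pair : {a b : Fin n} → a ≢ b → ∀ v → χ (⁅ a ⁆ ∪ ⁅ b ⁆) v ≡ χ ⁅ a ⁆ v + χ ⁅ b ⁆ v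
χ-pair {a = a} {b} a≢b v with v ∈? ⁅ a ⁆
... | no v∉a = χ-∪ʳ {S = ⁅ a ⁆} v∉a
... | yes v∈a = trans (χ-in {S = ⁅ a ⁆ ∪ ⁅ b ⁆} (x∈p∪q⁺ (inj₁ v∈a)))
  (cong suc (sym (χ-out {S = ⁅ b ⁆} λ v∈b → a≢b (trans (sym (x∈⁅y⁆⇒x≡y a v∈a)) (x∈⁅y⁆⇒x≡y b v∈b)))))

record Paired {n} (us : List (Fin n)) : Set where
  field
    twos≡2 : All (λ s → ∣ s ∣ ≡ 2) (proj₁ (pairUp us))
    ones≡1 : All (λ s → ∣ s ∣ ≡ 1) (proj₂ (pairUp us))
    ones≤1 : length (proj₂ (pairUp us)) ≤ 1
    counts : ∀ v → cnt (proj₁ (pairUp us)) v + cnt (proj₂ (pairUp us)) v ≡ occ us v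

open Paired

pairUp-correct : {us : List (Fin n)} → AllPairs _≢_ us → Paired us
pairUp-correct {us = []} _ = record { twos≡2 = [] ; ones≡1 = [] ; ones≤1 = z≤n ; counts = λ _ → refl }
pairUp-correct {us = a ∷ []} _ = record { twos≡2 = [] ; ones≡1 = ∣⁅x⁆∣≡1 a ∷ [] ; ones≤1 = ≤-refl ; counts = λ _ → refl }
pairUp-correct {us = a ∷ b ∷ us} ((a≢b ∷ _) ∷ _ ∷ us≢) = record
  { twos≡2 = ∣pair∣ a≢b ∷ twos≡2 ih ; ones≡1 = ones≡1 ih ; ones≤1 = ones≤1 ih
  ; counts = λ v → trans (cong (λ p → p + _ + _) (χ-pair a≢b v))
      (trans (regroup (χ ⁅ a ⁆ v) (χ ⁅ b ⁆ v) _ _) (cong (λ r → χ ⁅ a ⁆ v + (χ ⁅ b ⁆ v + r)) (counts ih v))) }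
  where ih = pairUp-correct us≢
        regroup : ∀ a b c d → a + b + c + d ≡ a + (b + (c + d))
        regroup = solve-∀

occ-filter : {P : Fin n → Set} (P? : Decidable P) (us : List (Fin n)) → AllPairs _≢_ us → (∀ v → v ∈ˡ us) →
             ∀ v → occ (filter P? us) v ≡ 𝟙 (P? v)
occ-filter P? us us≢ all v = go us us≢ (all v)
  where
  absent : ∀ ws → (∀ {w} → w ∈ˡ ws → v ≢ w) → occ (filter P? ws) v ≡ 0
  absent [] _ = refl
  absent (w ∷ ws) v∉ with P? w
  ... | no _ = absent ws (v∉ ∘ there)
  ... | yes _ = cong₂ _+_ (χ-out {S = ⁅ w ⁆} (v∉ (here refl) ∘ x∈⁅y⁆⇒x≡y w)) (absent ws (v∉ ∘ there))
  go : ∀ ws → AllPairs _≢_ ws → v ∈ˡ ws → occ (filter P? ws) v ≡ 𝟙 (P? v)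
  go (w ∷ ws) (w≢ ∷ _) (here refl) with P? w
  ... | yes _ = cong₂ _+_ (χ-in (x∈⁅x⁆ w)) (absent ws (All.lookup w≢))
  ... | no _ = absent ws (All.lookup w≢)
  go (w ∷ ws) (w≢ ∷ ws≢) (there v∈) with P? w
  ... | no _ = go ws ws≢ v∈
  ... | yes _ = cong₂ _+_ (χ-out {S = ⁅ w ⁆} (λ v∈w → All.lookup w≢ v∈ (sym (x∈⁅y⁆⇒x≡y w v∈w)))) (go ws ws≢ v∈)

once⇒covers : {C : List (Subset n)} → (∀ v → 0 < cnt C v) → Covers C
once⇒covers {C = C} pos v = let S , S∈C , v∈S = cnt>0⇒∈ C v (pos v) in Any.map (λ { refl → v∈S }) S∈C

completion : {P : List (Subset n)} → Packed P → ∃[ C ] Completes P C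
completion {n} {P} pk = P ++ twos ++ ones , twos , ones , refl , twos≡2 paired , ones≡1 paired , ones≤1 paired ,
  packed⇒disjoint (packed λ v → ≤-reflexive (once v)) , once⇒covers (λ v → ≤-reflexive (sym (once v)))
  where
  uncovered? : (v : Fin n) → Dec (cnt P v ≡ 0)
  uncovered? v = cnt P v ≟ 0
  us = filter uncovered? (allFin n)
  twos = proj₁ (pairUp us)
  ones = proj₂ (pairUp us)
  paired = pairUp-correct (AllPairsₚ.filter⁺ uncovered? (allFin⁺ n))
  once : ∀ v → cnt (P ++ twos ++ ones) v ≡ 1
  once v = trans (∑ₗ-++ _ P _) (trans (cong (cnt P v +_) (trans (∑ₗ-++ _ twos ones) (trans (counts paired v)
      (occ-filter uncovered? (allFin n) (allFin⁺ n) ∈-allFin v)))) (exactly (cnt P v) (pk .atMostOnce v)))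
    where exactly : ∀ c → c ≤ 1 → c + 𝟙 (c ≟ 0) ≡ 1
          exactly 0 _ = refl
          exactly 1 _ = refl
          exactly (suc (suc _)) (s≤s ())

∣∣≡1⇒unique : (S : Subset n) → ∣ S ∣ ≡ 1 → ∀ {x y} → x ∈ S → y ∈ S → x ≡ y
∣∣≡1⇒unique S S≡1 {x} {y} x∈S y∈S with x ≟ᶠ y
... | yes x≡y = x≡y
... | no x≢y = absurd (≤-trans (≤-reflexive (sym (cong₂ _+_ (χ-in x∈S) (χ-in y∈S))))
                 (≤-trans (∑-two (χ S) x≢y) (≤-reflexive (trans (sym (∣∣≡∑χ S)) S≡1)))) (s≤s (s≤s z≤n))

module _ (I : Instance n) where

  completes-feasible : ∀ {S P C} → Feasible I S → Packing I P → Completes P C → Feasible I C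
  completes-feasible {S} (availS , _ , coverS) (allP , _) (twos , ones , refl , all2 , all1 , _ , C# , coverC) =
    Allₚ.++⁺ (All.map proj₁ allP) (Allₚ.++⁺ (All.map two all2) (All.map one all1)) , C# , coverC
    where
    two : ∀ {s} → ∣ s ∣ ≡ 2 → Available I s
    two {s} s≡2 = ∣∣>0⇒nonempty s (≤-trans (s≤s z≤n) (≤-reflexive (sym s≡2))) , ∈⇒⊆ (pairs I s s≡2)
      where ∈⇒⊆ : ∀ {F} → s ∈ˡ F → Any (s ⊆_) F
            ∈⇒⊆ (here refl) = here id
            ∈⇒⊆ (there s∈F) = there (∈⇒⊆ s∈F)
    -- `pairs` says nothing about 1-sets; availability is inherited from the set of the starting
    -- cover that contains the element.
    one : ∀ {s} → ∣ s ∣ ≡ 1 → Available I s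
    one {s} s≡1 with ∣∣>0⇒nonempty s (≤-reflexive (sym s≡1))
    ... | x , x∈s = (x , x∈s) , go availS (coverS x)
      where
      go : ∀ {D} → All (Available I) D → Any (x ∈_) D → Any (s ⊆_) (family I)
      go ((_ , t⊆) ∷ _) (here {t} x∈t) = shrink-⊆ (λ y∈s → subst (_∈ t) (∣∣≡1⇒unique s s≡1 x∈s y∈s) x∈t) t⊆
      go (_ ∷ avail) (there x∈) = go avail x∈

  A2-terminates : ∀ k {S} → Feasible I S → A2Terminates I k S
  A2-terminates k {S} feas =
    let P , S⇝P , opt = localSearch I k (bigSets S) (improvement-wf I k (bigSets S))
        C , compl = completion (packing⇒packed I (search-packing I (bigSets-packing I feas) S⇝P))
    in improvement-wf I k (bigSets S) , C , P , S⇝P , opt , compl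

-- Exchanging the edges at a few 4-sets

-- The default `⊥` has size 0, so an uncovered element counts as lying neither in a 4-set nor in a
-- 3-set.
find : List (Subset n) → Fin n → Subset n
find [] v = ⊥
find (S ∷ C) v = if does (v ∈? S) then S else find C v

find-∈ : {C : List (Subset n)} {S : Subset n} {v : Fin n} → Packed C → S ∈ˡ C → v ∈ S → find C v ≡ S
find-∈ {C = T ∷ C} {v = v} pk S∈C v∈S with v ∈? T
... | yes v∈T = packed-unique pk (here refl) S∈C v∈T v∈S
find-∈ pk (here refl) v∈S | no v∉T = contradiction v∈S v∉T
find-∈ pk (there S∈C) v∈S | no _ = find-∈ (packed-tail pk) S∈C v∈S

find-or : (C : List (Subset n)) (v : Fin n) → (find C v ∈ˡ C × v ∈ find C v) ⊎ find C v ≡ ⊥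
find-or [] v = inj₂ refl
find-or (S ∷ C) v with v ∈? S
... | yes v∈S = inj₁ (here refl , v∈S)
... | no _ = [ (λ (f∈C , v∈f) → inj₁ (there f∈C , v∈f)) , inj₂ ]′ (find-or C v)

distinct⇒packed : {P Z : List (Subset n)} → Packed P → All (_∈ˡ P) Z → AllPairs _≢_ Z → Packed Z
distinct⇒packed {P = P} pk Z⊆P Z≢ = disjoint⇒packed (go Z⊆P Z≢)
  where
  go : ∀ {Z} → All (_∈ˡ P) Z → AllPairs _≢_ Z → AllPairs Disjoint Z
  go [] [] = []
  go {S ∷ Z} (S∈P ∷ Z⊆P) (S≢ ∷ Z≢) =
    All.tabulate (λ T∈Z (v , v∈) → let v∈S , v∈T = x∈p∩q⁻ S _ v∈ in
      All.lookup S≢ T∈Z (packed-unique pk S∈P (All.lookup Z⊆P T∈Z) v∈S v∈T)) ∷ go Z⊆P Z≢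

-- 4 minus the weight of what is left of a 4-set that has lost d elements.
saving : ℕ → ℕ
saving 0 = 0
saving 1 = 3
saving _ = 4

residual-centre : ∀ r m → r + m ≡ 4 → 4 ≤ weight r + saving m
residual-centre 0 4 refl = ≤-refl
residual-centre 1 3 refl = ≤-refl
residual-centre 2 2 refl = ≤-refl
residual-centre 3 1 refl = ≤-refl
residual-centre 4 0 refl = ≤-refl

-- For a 4-set that is not a centre: the first lost element costs 3 and later ones less, but the
-- bound charges 3 for each, so that the loss becomes a sum over elements.
residual-four : ∀ r m → r + m ≡ 4 → 4 ≤ weight r + 3 * m
residual-four 0 4 refl = s≤s (s≤s (s≤s (s≤s z≤n)))
residual-four 1 3 refl = s≤s (s≤s (s≤s (s≤s z≤n)))
residual-four 2 2 refl = s≤s (s≤s (s≤s (s≤s z≤n)))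
residual-four 3 1 refl = ≤-refl
residual-four 4 0 refl = ≤-refl

residual-three : ∀ r m → r + m ≡ 3 → 1 ≤ weight r + m
residual-three 0 3 refl = s≤s z≤n
residual-three 1 2 refl = s≤s z≤n
residual-three 2 1 refl = s≤s z≤n
residual-three 3 0 refl = s≤s z≤n

module Exchange {n : ℕ} (I : Instance n) (k : ℕ) (P : List (Subset n)) (packP : Packing I P)
  (opt : LocalOptimum I k P) where

  packedP : Packed P
  packedP = packing⇒packed I packP

  p : Fin n → Subset n
  p = find P

  a b : Fin n → ℕ
  a v = 𝟙 (∣ p v ∣ ≟ 4)
  b v = 𝟙 (∣ p v ∣ ≟ 3)

  p≡ : ∀ {S v} → S ∈ˡ P → v ∈ S → p v ≡ S
  p≡ = find-∈ packedP

  data Size (S : Subset n) : Set where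
    four : ∣ S ∣ ≡ 4 → Size S
    three : ∣ S ∣ ≡ 3 → Size S

  size : ∀ {S} → S ∈ˡ P → Size S
  size {S} S∈P with ∣ S ∣ in eq | All.lookup (proj₁ packP) S∈P
  ... | 3 | _ = three eq
  ... | 4 | _ = four eq
  ... | 0 | _ , () , _
  ... | 1 | _ , s≤s () , _
  ... | 2 | _ , s≤s (s≤s ()) , _
  ... | suc (suc (suc (suc (suc _)))) | _ , _ , s≤s (s≤s (s≤s (s≤s ())))

  a-four : ∀ {S v} → S ∈ˡ P → ∣ S ∣ ≡ 4 → v ∈ S → a v ≡ 1 × b v ≡ 0
  a-four S∈P S≡4 v∈S rewrite p≡ S∈P v∈S | S≡4 = refl , refl

  a-three : ∀ {S v} → S ∈ˡ P → ∣ S ∣ ≡ 3 → v ∈ S → a v ≡ 0 × b v ≡ 1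
  a-three S∈P S≡3 v∈S rewrite p≡ S∈P v∈S | S≡3 = refl , refl

  FourSets : List (Subset n) → Set
  FourSets Z = All (λ S → S ∈ˡ P × ∣ S ∣ ≡ 4) Z

  -- Zero on the centres `Z`, whose losses are measured exactly by `saving` instead of element by
  -- element.
  cost : List (Subset n) → Fin n → ℕ
  cost Z v = (1 ∸ cnt Z v) * (3 * a v + b v)

  hits : List (Subset n) → Subset n → ℕ
  hits E S = ∑ (λ v → χ S v * cnt E v)

  -- The loss of every touched set is bounded separately: by `saving` for a centre, by 3 or 1 per
  -- element otherwise. The size of `E` may replace the number of touched sets, since each of these
  -- contains an element of `E`.
  exchange-cost : ∀ {E} Z → FourSets Z → Packing I E → ∑ₗ ∣_∣ E ≤ k →
    ∑ₗ (λ s → weight ∣ s ∣) E ≤ ∑ (λ v → cnt E v * cost Z v) + ∑ₗ (λ S → saving (hits E S)) Z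
  exchange-cost {E} Z fourZ packE E≤k = +-cancelʳ-≤ (∑ₗ left R) _ _ (begin
    ∑ₗ (λ s → weight ∣ s ∣) E + ∑ₗ left R  ≤⟨ exchange I opt packP packE (≤-trans R≤E E≤k) ⟩
    ∑ₗ (λ s → weight ∣ s ∣) R  ≤⟨ ∑ₗ-mono R (λ S∈R → per-set (R⊆P S∈R)) ⟩
    ∑ₗ (λ S → left S + (∑ (λ v → χ S v * (cnt E v * cost Z v)) + centre S)) R ≡⟨ ∑ₗ-distrib-+ left _ R ⟩
    ∑ₗ left R + ∑ₗ (λ S → ∑ (λ v → χ S v * (cnt E v * cost Z v)) + centre S) R
      ≡⟨ cong (∑ₗ left R +_) (∑ₗ-distrib-+ _ centre R) ⟩
    ∑ₗ left R + (∑ₗ (λ S → ∑ (λ v → χ S v * (cnt E v * cost Z v))) R + ∑ₗ centre R)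
      ≤⟨ +-monoʳ-≤ (∑ₗ left R) (+-mono-≤ (restrict _) centres) ⟩
    ∑ₗ left R + (∑ (λ v → cnt E v * cost Z v) + ∑ₗ (λ S → saving (hits E S)) Z) ≡⟨ +-comm (∑ₗ left R) _ ⟩
    ∑ (λ v → cnt E v * cost Z v) + ∑ₗ (λ S → saving (hits E S)) Z + ∑ₗ left R ∎)
    where
    open ≤-Reasoning
    U = ⋃ E
    R = touched I E P
    left centre : Subset n → ℕ
    left S = weight ∣ S ─ U ∣
    -- Membership in `Z` is written as a sum, so that the sums over `R` and `Z` can be interchanged
    -- in `centres`.
    centre S = ∑ₗ (λ T → 𝟙 (S ≟ˢ T) * saving (hits E T)) Z

    packedE : Packed E
    packedE = packing⇒packed I packE

    R⊆P : ∀ {S} → S ∈ˡ R → S ∈ˡ P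
    R⊆P S∈R = proj₁ (∈-filter⁻ (touches? U) {xs = P} S∈R)

    packedR : Packed R
    packedR .atMostOnce v = ≤-trans (≤-trans (m≤m+n _ _) (≤-reflexive (sym (∑ₗ-filter (touches? U) (λ S → χ S v) P))))
                                    (packedP .atMostOnce v)

    restrict : ∀ f → ∑ₗ (λ S → ∑ (λ v → χ S v * f v)) R ≤ ∑ f
    restrict f = ≤-trans (≤-reflexive (∑ₗ-∑χ R f))
      (∑-mono (λ v → ≤-trans (*-monoˡ-≤ (f v) (packedR .atMostOnce v)) (≤-reflexive (*-identityˡ (f v)))))

    hits≡ : ∀ S → ∣ S ∩ U ∣ ≡ hits E S
    hits≡ S = trans (∣∩∣≡∑ S U) (sum-cong-≗ (λ v → cong (χ S v *_) (χ-⋃ packedE v)))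

    R≤E : length R ≤ ∑ₗ ∣_∣ E
    R≤E = begin
      length R ≡⟨ *-identityʳ (length R) ⟨
      length R * 1 ≡⟨ ∑ₗ-const 1 R ⟨
      ∑ₗ (λ _ → 1) R ≤⟨ ∑ₗ-mono R meets ⟩
      ∑ₗ (λ S → hits E S) R ≤⟨ restrict (cnt E) ⟩
      ∑ (cnt E) ≡⟨ ∑ₗ-∣∣ E ⟨
      ∑ₗ ∣_∣ E ∎
      where
      meets : ∀ {S} → S ∈ˡ R → 1 ≤ hits E S
      meets {S} S∈R with proj₂ (∈-filter⁻ (touches? U) {xs = P} S∈R)
      ... | v , v∈ = ≤-trans (≤-trans (≤-reflexive (sym (χ-in v∈))) (∑-point (χ (S ∩ U)) v))
                             (≤-reflexive (trans (sym (∣∣≡∑χ (S ∩ U))) (hits≡ S)))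

    leftover : ∀ S {m} → ∣ S ∣ ≡ m → ∣ S ─ U ∣ + hits E S ≡ m
    leftover S S≡m = trans (cong (∣ S ─ U ∣ +_) (sym (hits≡ S))) (trans (∣─∣+∣∩∣ S U) S≡m)

    centres : ∑ₗ centre R ≤ ∑ₗ (λ S → saving (hits E S)) Z
    centres = begin
      ∑ₗ centre R ≡⟨ ∑ₗ-comm (λ S T → 𝟙 (S ≟ˢ T) * saving (hits E T)) R Z ⟩
      ∑ₗ (λ T → ∑ₗ (λ S → 𝟙 (S ≟ˢ T) * saving (hits E T)) R) Z ≤⟨ ∑ₗ-mono Z single ⟩
      ∑ₗ (λ S → saving (hits E S)) Z ∎
      where
      single : ∀ {T} → T ∈ˡ Z → ∑ₗ (λ S → 𝟙 (S ≟ˢ T) * saving (hits E T)) R ≤ saving (hits E T)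
      single {T} T∈Z with ∣∣>0⇒nonempty T (≤-trans (s≤s z≤n) (≤-reflexive (sym (proj₂ (All.lookup fourZ T∈Z)))))
      ... | x , x∈T = begin
        ∑ₗ (λ S → 𝟙 (S ≟ˢ T) * s) R   ≤⟨ ∑ₗ-mono R (λ {S} _ → *-monoˡ-≤ s (contains S)) ⟩
        ∑ₗ (λ S → χ S x * s) R        ≡⟨ ∑ₗ-cong R (λ {S} _ → *-comm (χ S x) s) ⟩
        ∑ₗ (λ S → s * χ S x) R        ≡⟨ ∑ₗ-distribˡ-* s _ R ⟩
        s * cnt R x                   ≤⟨ *-monoʳ-≤ s (packedR .atMostOnce x) ⟩
        s * 1                         ≡⟨ *-identityʳ s ⟩
        s                             ∎
        where
        s = saving (hits E T)
        contains : ∀ S → 𝟙 (S ≟ˢ T) ≤ χ S x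
        contains S = case S ≟ˢ T of λ where
          (yes S≡T) → ≤-trans (𝟙≤1 (S ≟ˢ T)) (≤-reflexive (sym (χ-in (subst (x ∈_) (sym S≡T) x∈T))))
          (no S≢T) → ≤-trans (≤-reflexive (𝟙-no (S ≟ˢ T) S≢T)) z≤n

    per-set : ∀ {S} → S ∈ˡ P → weight ∣ S ∣ ≤ left S + (∑ (λ v → χ S v * (cnt E v * cost Z v)) + centre S)
    per-set {S} S∈P = case Any.any? (S ≟ˢ_) Z of λ where
        (yes S∈Z) → let S≡4 = proj₂ (All.lookup fourZ S∈Z) in begin
          weight ∣ S ∣ ≡⟨ cong weight S≡4 ⟩
          4 ≤⟨ residual-centre ∣ S ─ U ∣ (hits E S) (leftover S S≡4) ⟩
          left S + saving (hits E S) ≡⟨ cong (left S +_) (trans (cong (_* saving (hits E S)) (𝟙-yes (S ≟ˢ S) refl)) (*-identityˡ _)) ⟨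
          left S + 𝟙 (S ≟ˢ S) * saving (hits E S) ≤⟨ +-monoʳ-≤ (left S) (∑ₗ-member (λ T → 𝟙 (S ≟ˢ T) * saving (hits E T)) S∈Z) ⟩
          left S + centre S ≤⟨ +-monoʳ-≤ (left S) (m≤n+m _ _) ⟩
          left S + (∑ (λ v → χ S v * (cnt E v * cost Z v)) + centre S) ∎
        (no S∉Z) → ≤-trans (outside-Z S∉Z (size S∈P)) (+-monoʳ-≤ (left S) (m≤m+n _ _))
      where
      uncounted : ¬ Any (S ≡_) Z → ∀ v → v ∈ S → cnt Z v ≡ 0
      uncounted S∉Z v v∈S = n≤0⇒n≡0 (cnt≤0 {C = Z} λ {T} T∈Z v∈T →
        S∉Z (subst (_∈ˡ Z) (packed-unique packedP (proj₁ (All.lookup fourZ T∈Z)) S∈P v∈T v∈S) T∈Z))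
      charge : ∀ c → ¬ Any (S ≡_) Z → (∀ v → v ∈ S → 3 * a v + b v ≡ c) →
               ∑ (λ v → χ S v * (cnt E v * cost Z v)) ≡ c * hits E S
      charge c S∉Z const = trans (∑χ-cong S (λ v v∈S → trans
          (cong (cnt E v *_) (trans (cong₂ (λ z w → (1 ∸ z) * w) (uncounted S∉Z v v∈S) (const v v∈S)) (*-identityˡ c)))
          (*-comm (cnt E v) c))) (∑χ-distribˡ-* S c (cnt E))
      outside-Z : ¬ Any (S ≡_) Z → Size S → weight ∣ S ∣ ≤ left S + ∑ (λ v → χ S v * (cnt E v * cost Z v))
      outside-Z S∉Z (four S≡4) = begin
        weight ∣ S ∣ ≡⟨ cong weight S≡4 ⟩
        4 ≤⟨ residual-four ∣ S ─ U ∣ (hits E S) (leftover S S≡4) ⟩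
        left S + 3 * hits E S ≡⟨ cong (left S +_) (charge 3 S∉Z (λ v v∈S → let a≡1 , b≡0 = a-four S∈P S≡4 v∈S in cong₂ (λ x y → 3 * x + y) a≡1 b≡0)) ⟨
        left S + ∑ (λ v → χ S v * (cnt E v * cost Z v)) ∎
      outside-Z S∉Z (three S≡3) = begin
        weight ∣ S ∣ ≡⟨ cong weight S≡3 ⟩
        1 ≤⟨ residual-three ∣ S ─ U ∣ (hits E S) (leftover S S≡3) ⟩
        left S + hits E S ≡⟨ cong (left S +_) (*-identityˡ (hits E S)) ⟨
        left S + 1 * hits E S ≡⟨ cong (left S +_) (charge 1 S∉Z (λ v v∈S → let a≡0 , b≡1 = a-three S∈P S≡3 v∈S in cong₂ (λ x y → 3 * x + y) a≡0 b≡1)) ⟨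
        left S + ∑ (λ v → χ S v * (cnt E v * cost Z v)) ∎

∑χ-point : (S : Subset n) (f : Fin n → ℕ) {v : Fin n} → v ∈ S → f v ≤ ∑ (λ x → χ S x * f x)
∑χ-point S f {v} v∈S = ≤-trans (≤-reflexive (sym (trans (cong (_* f v) (χ-in v∈S)) (*-identityˡ (f v)))))
  (∑-point (λ x → χ S x * f x) v)

∑χ-two : (S : Subset n) (f : Fin n → ℕ) {v u : Fin n} → v ≢ u → v ∈ S → u ∈ S → f v + f u ≤ ∑ (λ x → χ S x * f x)
∑χ-two S f {v} {u} v≢u v∈S u∈S = ≤-trans (≤-reflexive (sym (cong₂ _+_
    (trans (cong (_* f v) (χ-in v∈S)) (*-identityˡ (f v))) (trans (cong (_* f u) (χ-in u∈S)) (*-identityˡ (f u))))))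
  (∑-two (λ x → χ S x * f x) v≢u)

∑χ-three : (S : Subset n) (f : Fin n → ℕ) {v u w : Fin n} → v ≢ u → v ≢ w → u ≢ w → v ∈ S → u ∈ S → w ∈ S →
           f v + f u + f w ≤ ∑ (λ x → χ S x * f x)
∑χ-three S f {v} {u} {w} v≢u v≢w u≢w v∈S u∈S w∈S = ≤-trans (≤-reflexive (sym (cong₂ _+_ (cong₂ _+_
    (trans (cong (_* f v) (χ-in v∈S)) (*-identityˡ (f v))) (trans (cong (_* f u) (χ-in u∈S)) (*-identityˡ (f u))))
    (trans (cong (_* f w) (χ-in w∈S)) (*-identityˡ (f w))))))
  (∑-three (λ x → χ S x * f x) v≢u v≢w u≢w)

χ*≡1 : (S : Subset n) (v : Fin n) {m : ℕ} → χ S v * m ≡ 1 → v ∈ S × m ≡ 1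
χ*≡1 S v {m} eq with v ∈? S
... | yes v∈S = v∈S , trans (sym (+-identityʳ m)) eq

𝟙≡1 : {P : Set} (d : Dec P) → 𝟙 d ≡ 1 → P
𝟙≡1 (yes p) _ = p

saving≤ : ∀ d → saving d ≤ d + 2
saving≤ 0 = z≤n
saving≤ 1 = ≤-refl
saving≤ (suc (suc d)) = s≤s (s≤s (m≤n+m 2 d))

-- `O` is a partition that may include empty sets, left over from making a cover disjoint; hence
-- availability is asked of nonempty members only.
module Local {n : ℕ} (I : Instance n) (k : ℕ) (P : List (Subset n)) (packP : Packing I P)
  (opt : LocalOptimum I k P) (100≤k : 100 ≤ k) (O : List (Subset n)) (once : ∀ v → cnt O v ≡ 1)
  (allO : All (λ o → ∣ o ∣ ≤ 4 × (Nonempty o → Available I o)) O) where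

  open Exchange I k P packP opt public

  packedO : Packed O
  packedO = packed (λ v → ≤-reflexive (once v))

  q : Fin n → Subset n
  q = find O

  q-∈ : ∀ v → q v ∈ˡ O × v ∈ q v
  q-∈ v with find-or O v
  ... | inj₁ found = found
  ... | inj₂ q≡⊥ = let o , o∈O , v∈o = cnt>0⇒∈ O v (≤-reflexive (sym (once v))) in
    contradiction (subst (v ∈_) (trans (sym (find-∈ packedO o∈O v∈o)) q≡⊥) v∈o) ∉⊥

  v∈q : ∀ v → v ∈ q v
  v∈q v = proj₂ (q-∈ v)

  i j : Subset n → ℕ
  i o = ∑ (λ v → χ o v * a v)
  j o = ∑ (λ v → χ o v * b v)

  O-packing : ∀ {E} → Packed E → (∀ {o} → o ∈ˡ E → o ∈ˡ O × 3 ≤ ∣ o ∣) → Packing I E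
  O-packing pk E⊆O = All.tabulate (λ {o} o∈E → let o∈O , 3≤o = E⊆O o∈E ; o≤4 , avail = All.lookup allO o∈O in
    avail (∣∣>0⇒nonempty o (≤-trans (s≤s z≤n) 3≤o)) , 3≤o , o≤4) , packed⇒disjoint pk

  -- Exchange of the single set `o`, without centres.
  weight≤3i+j : ∀ {o} → o ∈ˡ O → 3 ≤ ∣ o ∣ → weight ∣ o ∣ ≤ 3 * i o + j o
  weight≤3i+j {o} o∈O 3≤o = begin
    weight ∣ o ∣ ≡⟨ +-identityʳ _ ⟨
    weight ∣ o ∣ + 0 ≤⟨ exchange-cost [] [] (O-packing [o]-packed λ { (here refl) → o∈O , 3≤o }) o≤k ⟩
    ∑ (λ v → (χ o v + 0) * (1 * (3 * a v + b v))) + 0 ≡⟨ +-identityʳ _ ⟩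
    ∑ (λ v → (χ o v + 0) * (1 * (3 * a v + b v))) ≡⟨ sum-cong-≗ (λ v → lemma (χ o v) (3 * a v + b v)) ⟩
    ∑ (λ v → χ o v * (3 * a v + b v)) ≡⟨ ∑χ-distrib-+ o (λ v → 3 * a v) b ⟩
    ∑ (λ v → χ o v * (3 * a v)) + j o ≡⟨ cong (_+ j o) (∑χ-distribˡ-* o 3 a) ⟩
    3 * i o + j o ∎
    where
    open ≤-Reasoning
    lemma : ∀ c d → (c + 0) * (1 * d) ≡ c * d
    lemma = solve-∀
    [o]-packed : Packed (o ∷ [])
    [o]-packed = packed (λ v → ≤-trans (≤-reflexive (+-identityʳ _)) (χ≤1 o v))
    o≤k : ∣ o ∣ + 0 ≤ k
    o≤k = ≤-trans (≤-reflexive (+-identityʳ _))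
      (≤-trans (proj₁ (All.lookup allO o∈O)) (≤-trans (s≤s (s≤s (s≤s (s≤s z≤n)))) 100≤k))

  a≤1 : ∀ v → a v ≤ 1
  a≤1 v = 𝟙≤1 (∣ p v ∣ ≟ 4)

  a≡1⇒b≡0 : ∀ v → a v ≡ 1 → b v ≡ 0
  a≡1⇒b≡0 v a≡1 = cong (λ m → 𝟙 (m ≟ 3)) (𝟙≡1 (∣ p v ∣ ≟ 4) a≡1)

  a≡1⇒p : ∀ v → a v ≡ 1 → p v ∈ˡ P × ∣ p v ∣ ≡ 4 × v ∈ p v
  a≡1⇒p v a≡1 with 𝟙≡1 (∣ p v ∣ ≟ 4) a≡1 | find-or P v
  ... | p≡4 | inj₁ (p∈P , v∈p) = p∈P , p≡4 , v∈p
  ... | p≡4 | inj₂ p≡⊥ = case trans (sym p≡4) (trans (cong ∣_∣ p≡⊥) (∣⊥∣≡0 n)) of λ ()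

  -- The two types of edges; i and j count the elements lying in 4-sets and 3-sets of P.
  AASet ABSet : Subset n → Set
  AASet o = ∣ o ∣ ≡ 4 × i o ≡ 2 × j o ≡ 0
  ABSet o = ∣ o ∣ ≡ 4 × i o ≡ 1 × j o ≡ 1

  AASet? : Decidable AASet
  AASet? o = ∣ o ∣ ≟ 4 ×-dec (i o ≟ 2 ×-dec j o ≟ 0)

  ABSet? : Decidable ABSet
  ABSet? o = ∣ o ∣ ≟ 4 ×-dec (i o ≟ 1 ×-dec j o ≟ 1)

  -- An edge seen from one of its ends in a 4-set. Working with elements keeps parallel edges apart
  -- and covers loops, where both ends lie in the same set of `P`.
  AASlot ABSlot : Fin n → Set
  AASlot v = a v ≡ 1 × AASet (q v)
  ABSlot v = a v ≡ 1 × ABSet (q v)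

  AASlot? : Decidable AASlot
  AASlot? v = a v ≟ 1 ×-dec AASet? (q v)

  ABSlot? : Decidable ABSlot
  ABSlot? v = a v ≟ 1 ×-dec ABSet? (q v)

  aa ab : Fin n → ℕ
  aa v = 𝟙 (AASlot? v)
  ab v = 𝟙 (ABSlot? v)

  AA⇒¬AB : ∀ {o} → AASet o → ¬ ABSet o
  AA⇒¬AB (_ , i≡2 , _) (_ , i≡1 , _) = case trans (sym i≡2) i≡1 of λ ()

  mate? : ∀ v → Dec (∃[ u ] (u ≢ v × 0 < χ (q v) u * a u))
  mate? v = any? (λ u → ¬? (u ≟ᶠ v) ×-dec 0 <? χ (q v) u * a u)

  -- The other end of an AA edge; the default `v` is never reached at an `AASlot`, because there `i`
  -- is 2.
  mate : Fin n → Fin n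
  mate v = case mate? v of λ where
    (yes (u , _)) → u
    (no _) → v

  χa≡1 : ∀ {o v} → v ∈ o → a v ≡ 1 → χ o v * a v ≡ 1
  χa≡1 v∈o a≡1 = cong₂ _*_ (χ-in v∈o) a≡1

  record Mate (v u : Fin n) : Set where
    field
      apart : u ≢ v
      u∈q : u ∈ q v
      a≡1 : a u ≡ 1

  open Mate

  mate-correct : ∀ {v} → AASlot v → Mate v (mate v)
  mate-correct {v} (av , _ , i≡2 , _) with mate? v
  ... | yes (u , u≢v , 0<) = let u∈ , au = χ*≡1 (q v) u (≤-antisym (*-mono-≤ (χ≤1 (q v) u) (a≤1 u)) 0<) in
                             record { apart = u≢v ; u∈q = u∈ ; a≡1 = au }
  ... | no none = case trans (sym i≡2) (trans (∑-supp₁ (λ x → χ (q v) x * a x) v (λ x x≢v → n≤0⇒n≡0 (≮⇒≥ λ 0< → none (x , x≢v , 0<))))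
                                              (χa≡1 (v∈q v) av)) of λ ()

  third-vanishes : ∀ {o v u} → i o ≡ 2 → v ∈ o → a v ≡ 1 → u ∈ o → a u ≡ 1 → u ≢ v →
                   ∀ x → x ∈ o → x ≢ v → x ≢ u → a x ≡ 0
  third-vanishes {o} i≡2 v∈o av u∈o au u≢v x x∈o x≢v x≢u = n≤0⇒n≡0 (+-cancelˡ-≤ 2 _ _
    (subst₂ (λ m l → m + l + a x ≤ 2) av au
      (≤-trans (∑χ-three o a (u≢v ∘ sym) (x≢v ∘ sym) (x≢u ∘ sym) v∈o u∈o x∈o) (≤-reflexive i≡2))))

  mate-unique : ∀ {v u} → AASlot v → Mate v u → mate v ≡ u
  mate-unique {v} {u} sv@(av , _ , i≡2 , _) m with mate v ≟ᶠ u
  ... | yes eq = eq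
  ... | no ≢u = let m′ = mate-correct sv in
    case trans (sym (a≡1 m′)) (third-vanishes i≡2 (v∈q v) av (u∈q m) (a≡1 m) (apart m) (mate v) (u∈q m′) (apart m′) ≢u) of λ ()

  q-mate : ∀ {v} → AASlot v → q (mate v) ≡ q v
  q-mate {v} sv = find-∈ packedO (proj₁ (q-∈ v)) (u∈q (mate-correct sv))

  mate-slot : ∀ {v} → AASlot v → AASlot (mate v)
  mate-slot sv = a≡1 (mate-correct sv) , subst AASet (sym (q-mate sv)) (proj₂ sv)

  mate-mate : ∀ {v} → AASlot v → mate (mate v) ≡ v
  mate-mate {v} sv = mate-unique (mate-slot sv)
    (record { apart = apart (mate-correct sv) ∘ sym ; u∈q = subst (v ∈_) (sym (q-mate sv)) (v∈q v) ; a≡1 = proj₁ sv })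

  -- Marks the ends of AA edges whose other end also lies in `Z`. Such an edge brings in weight 4
  -- without any cost outside `Z`.
  inn : List (Subset n) → Fin n → ℕ
  inn Z v = aa v * cnt Z (mate v)

  dA dB : Subset n → ℕ
  dA S = ∑ (λ v → χ S v * aa v)
  dB S = ∑ (λ v → χ S v * ab v)

  inner : List (Subset n) → Subset n → ℕ
  inner Z S = ∑ (λ v → χ S v * inn Z v)

  module Centres (Z : List (Subset n)) (fourZ : FourSets Z) (packedZ : Packed Z) (Z≤4 : length Z ≤ 4) where

    Edge : Subset n → Set
    Edge o = (AASet o ⊎ ABSet o) × (∃[ v ] (v ∈ o × 0 < cnt Z v))

    Edge? : Decidable Edge
    Edge? o = (AASet? o ⊎-dec ABSet? o) ×-dec any? (λ v → v ∈? o ×-dec 0 <? cnt Z v)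

    E : List (Subset n)
    E = filter Edge? O

    E⁻ : ∀ {o} → o ∈ˡ E → o ∈ˡ O × Edge o
    E⁻ = ∈-filter⁻ Edge? {xs = O}

    packedE : Packed E
    packedE .atMostOnce v = ≤-trans (≤-trans (m≤m+n _ _) (≤-reflexive (sym (∑ₗ-filter Edge? (λ S → χ S v) O))))
                                    (packedO .atMostOnce v)

    E≡4 : ∀ {o} → o ∈ˡ E → ∣ o ∣ ≡ 4
    E≡4 o∈E = [ proj₁ , proj₁ ]′ (proj₁ (proj₂ (E⁻ o∈E)))

    packE : Packing I E
    packE = O-packing packedE (λ o∈E → proj₁ (E⁻ o∈E) , ≤-trans (n≤1+n 3) (≤-reflexive (sym (E≡4 o∈E))))

    -- Every edge in `E` contains one of the at most 16 elements of `Z` and the edges are disjoint,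
    -- so there are at most 16 of them, with 64 elements.
    ∑E≤k : ∑ₗ ∣_∣ E ≤ k
    ∑E≤k = begin
      ∑ₗ ∣_∣ E ≡⟨ ∑ₗ-cong E E≡4 ⟩
      ∑ₗ (λ _ → 4 * 1) E ≤⟨ ∑ₗ-mono E (λ {o} o∈E → let v , v∈o , 0<Z = proj₂ (proj₂ (E⁻ o∈E)) in
                              *-monoʳ-≤ 4 (≤-trans 0<Z (∑χ-point o (cnt Z) v∈o))) ⟩
      ∑ₗ (λ o → 4 * ∑ (λ v → χ o v * cnt Z v)) E ≡⟨ ∑ₗ-distribˡ-* 4 _ E ⟩
      4 * ∑ₗ (λ o → ∑ (λ v → χ o v * cnt Z v)) E ≡⟨ cong (4 *_) (∑ₗ-∑χ E (cnt Z)) ⟩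
      4 * ∑ (λ v → cnt E v * cnt Z v) ≤⟨ *-monoʳ-≤ 4 (∑-mono (λ v → ≤-trans (*-monoˡ-≤ (cnt Z v) (packedE .atMostOnce v)) (≤-reflexive (*-identityˡ _)))) ⟩
      4 * ∑ (cnt Z) ≡⟨ cong (4 *_) (∑ₗ-∣∣ Z) ⟨
      4 * ∑ₗ ∣_∣ Z ≡⟨ cong (4 *_) (trans (∑ₗ-cong Z (proj₂ ∘ All.lookup fourZ)) (∑ₗ-const 4 Z)) ⟩
      4 * (length Z * 4) ≤⟨ *-monoʳ-≤ 4 (*-monoˡ-≤ 4 Z≤4) ⟩
      64 ≤⟨ m≤m+n 64 36 ⟩
      100 ≤⟨ 100≤k ⟩
      k ∎
      where open ≤-Reasoning

    Z⇒a : ∀ {v} → 0 < cnt Z v → a v ≡ 1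
    Z⇒a {v} 0<Z = let S , S∈Z , v∈S = cnt>0⇒∈ Z v 0<Z ; S∈P , S≡4 = All.lookup fourZ S∈Z in
      proj₁ (a-four S∈P S≡4 v∈S)

    ¬a⇒Z≡0 : ∀ {v} → a v ≡ 0 → cnt Z v ≡ 0
    ¬a⇒Z≡0 a≡0 = n≤0⇒n≡0 (≮⇒≥ λ 0<Z → case trans (sym (Z⇒a 0<Z)) a≡0 of λ ())

    -- An edge spends 4 on its two ends: an inner edge 2 + 2, an edge from Z to another
    -- 4-set 1 + 3, an edge from Z to a 3-set 3 + 1.
    φ : Fin n → ℕ
    φ v = cnt Z v * (1 + 2 * ab v + inn Z v) + cost Z v

    φ-eval : ∀ {v z s t x y} → cnt Z v ≡ z → ab v ≡ s → inn Z v ≡ t → a v ≡ x → b v ≡ y →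
             φ v ≡ z * (1 + 2 * s + t) + (1 ∸ z) * (3 * x + y)
    φ-eval refl refl refl refl refl = refl

    φ-uncovered : ∀ {v} → a v ≡ 0 → b v ≡ 0 → φ v ≡ 0
    φ-uncovered a≡0 b≡0 = φ-eval (¬a⇒Z≡0 a≡0) refl refl a≡0 b≡0

    j≡0⇒b≡0 : ∀ {o x} → j o ≡ 0 → x ∈ o → b x ≡ 0
    j≡0⇒b≡0 {o} j≡0 x∈o = n≤0⇒n≡0 (≤-trans (∑χ-point o b x∈o) (≤-reflexive j≡0))

    edge-φ-AA : ∀ {v} → AASlot v → 0 < cnt Z v → ∑ (λ x → χ (q v) x * φ x) ≤ 4
    edge-φ-AA {v} sv@(av , _ , i≡2 , j≡0) 0<Z = begin
      ∑ (λ x → χ (q v) x * φ x) ≡⟨ ∑-supp₂ (λ x → χ (q v) x * φ x) (apart m ∘ sym) off ⟩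
      χ (q v) v * φ v + χ (q v) u * φ u ≡⟨ cong₂ (λ x y → x * φ v + y * φ u) (χ-in (v∈q v)) (χ-in (u∈q m)) ⟩
      1 * φ v + 1 * φ u ≡⟨ cong₂ _+_ (*-identityˡ (φ v)) (*-identityˡ (φ u)) ⟩
      φ v + φ u ≡⟨ cong₂ _+_ (φ-eval Zv≡1 (noab sv) (trans (cong (_* cnt Z u) (𝟙-yes (AASlot? v) sv)) (*-identityˡ _)) av (a≡1⇒b≡0 v av))
                             (φ-eval refl (noab su) (trans (cong₂ (λ x y → x * cnt Z y) (𝟙-yes (AASlot? u) su) (mate-mate sv)) (trans (*-identityˡ _) Zv≡1)) (a≡1 m) (a≡1⇒b≡0 u (a≡1 m))) ⟩
      1 * (1 + 2 * 0 + cnt Z u) + 0 + (cnt Z u * (1 + 2 * 0 + 1) + (1 ∸ cnt Z u) * 3) ≤⟨ arith (cnt Z u) (packedZ .atMostOnce u) ⟩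
      4 ∎
      where
      open ≤-Reasoning
      m = mate-correct sv
      u = mate v
      su = mate-slot sv
      Zv≡1 : cnt Z v ≡ 1
      Zv≡1 = ≤-antisym (packedZ .atMostOnce v) 0<Z
      noab : ∀ {x} → AASlot x → ab x ≡ 0
      noab {x} sx = 𝟙-no (ABSlot? x) (AA⇒¬AB (proj₂ sx) ∘ proj₂)
      arith : ∀ c → c ≤ 1 → 1 * (1 + 2 * 0 + c) + 0 + (c * (1 + 2 * 0 + 1) + (1 ∸ c) * 3) ≤ 4
      arith 0 _ = ≤-refl
      arith 1 _ = ≤-refl
      arith (suc (suc _)) (s≤s ())
      off : ∀ x → x ≢ v → x ≢ u → χ (q v) x * φ x ≡ 0
      off x x≢v x≢u with x ∈? q v
      ... | no _ = refl
      ... | yes x∈ = trans (*-identityˡ _) (φ-uncovered (third-vanishes i≡2 (v∈q v) av (u∈q m) (a≡1 m) (apart m) x x∈ x≢v x≢u) (j≡0⇒b≡0 j≡0 x∈))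

    edge-φ-AB : ∀ {v} → ABSlot v → 0 < cnt Z v → ∑ (λ x → χ (q v) x * φ x) ≤ 4
    edge-φ-AB {v} sv@(av , _ , i≡1 , j≡1) 0<Z with ∑≡1⇒point (λ x → χ (q v) x * b x) j≡1
    ... | u , χb≡1 , others = ≤-reflexive (begin
      ∑ (λ x → χ (q v) x * φ x) ≡⟨ ∑-supp₂ (λ x → χ (q v) x * φ x) v≢u off ⟩
      χ (q v) v * φ v + χ (q v) u * φ u ≡⟨ cong₂ (λ x y → x * φ v + y * φ u) (χ-in (v∈q v)) (χ-in u∈) ⟩
      1 * φ v + 1 * φ u ≡⟨ cong₂ _+_ (*-identityˡ (φ v)) (*-identityˡ (φ u)) ⟩
      φ v + φ u ≡⟨ cong₂ _+_ (φ-eval Zv≡1 (𝟙-yes (ABSlot? v) sv) (cong (_* cnt Z (mate v)) (𝟙-no (AASlot? v) λ s → AA⇒¬AB (proj₂ s) (proj₂ sv))) av (a≡1⇒b≡0 v av))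
                             (φ-eval (¬a⇒Z≡0 au≡0) refl refl au≡0 bu≡1) ⟩
      4 ∎)
      where
      open ≡-Reasoning
      u∈ = proj₁ (χ*≡1 (q v) u χb≡1)
      bu≡1 = proj₂ (χ*≡1 (q v) u χb≡1)
      Zv≡1 : cnt Z v ≡ 1
      Zv≡1 = ≤-antisym (packedZ .atMostOnce v) 0<Z
      v≢u : v ≢ u
      v≢u refl = case trans (sym bu≡1) (a≡1⇒b≡0 v av) of λ ()
      a≡0 : ∀ {x} → x ∈ q v → v ≢ x → a x ≡ 0
      a≡0 {x} x∈ v≢x = n≤0⇒n≡0 (+-cancelˡ-≤ 1 _ _ (subst (λ m → m + a x ≤ 1) av
        (≤-trans (∑χ-two (q v) a v≢x (v∈q v) x∈) (≤-reflexive i≡1))))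
      au≡0 : a u ≡ 0
      au≡0 = a≡0 u∈ v≢u
      off : ∀ x → x ≢ v → x ≢ u → χ (q v) x * φ x ≡ 0
      off x x≢v x≢u with x ∈? q v | others x x≢u
      ... | no _ | _ = refl
      ... | yes x∈ | b≡0 = trans (*-identityˡ _) (φ-uncovered (a≡0 x∈ (x≢v ∘ sym)) (trans (sym (*-identityˡ (b x))) b≡0))

    edge-φ : ∀ {o} → o ∈ˡ E → ∑ (λ x → χ o x * φ x) ≤ 4
    edge-φ o∈E with E⁻ o∈E
    ... | o∈O , kind , v , v∈o , 0<Z with find-∈ packedO o∈O v∈o
    ...   | refl = [ (λ s → edge-φ-AA (Z⇒a 0<Z , s) 0<Z) , (λ s → edge-φ-AB (Z⇒a 0<Z , s) 0<Z) ]′ kind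

    cnt-E : ∀ {v} → 0 < cnt Z v → cnt E v ≡ aa v + ab v
    cnt-E {v} 0<Z = case AASlot? v of λ where
        (yes s) → trans (in-E (inj₁ (proj₂ s))) (sym (cong₂ _+_ (𝟙-yes (AASlot? v) s) (𝟙-no (ABSlot? v) (AA⇒¬AB (proj₂ s) ∘ proj₂))))
        (no ¬s) → case ABSlot? v of λ where
          (yes t) → trans (in-E (inj₂ (proj₂ t))) (sym (cong₂ _+_ (𝟙-no (AASlot? v) ¬s) (𝟙-yes (ABSlot? v) t)))
          (no ¬t) → trans (n≤0⇒n≡0 (cnt≤0 {C = E} λ o∈E v∈o → let o∈O , kind , _ = E⁻ o∈E ; q≡o = find-∈ packedO o∈O v∈o in
              [ (λ s → ¬s (av , subst AASet (sym q≡o) s)) , (λ t → ¬t (av , subst ABSet (sym q≡o) t)) ]′ kind))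
            (sym (cong₂ _+_ (𝟙-no (AASlot? v) ¬s) (𝟙-no (ABSlot? v) ¬t)))
      where
      av = Z⇒a 0<Z
      in-E : AASet (q v) ⊎ ABSet (q v) → cnt E v ≡ 1
      in-E kind = ≤-antisym (packedE .atMostOnce v)
        (∈⇒cnt>0 (∈-filter⁺ Edge? (proj₁ (q-∈ v)) (kind , v , v∈q v , 0<Z)) (v∈q v))

    gain : Fin n → ℕ
    gain v = 1 + 2 * ab v + inn Z v

    gain≥ : ∀ {v} → aa v + 3 * ab v + inn Z v ≤ (aa v + ab v) * gain v
    gain≥ {v} = arith (AASlot? v) (ABSlot? v) (cnt Z (mate v)) (λ s t → AA⇒¬AB (proj₂ s) (proj₂ t))
      where
      arith : ∀ {A B : Set} (s : Dec A) (t : Dec B) c → (A → ¬ B) →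
              𝟙 s + 3 * 𝟙 t + 𝟙 s * c ≤ (𝟙 s + 𝟙 t) * (1 + 2 * 𝟙 t + 𝟙 s * c)
      arith (yes s) (yes t) _ ¬both = contradiction t (¬both s)
      arith (yes _) (no _) c _ = ≤-reflexive (sym (+-identityʳ _))
      arith (no _) (yes _) _ _ = ≤-refl
      arith (no _) (no _) _ _ = z≤n

    -- The weight 4 of each edge pays for `φ` at its ends. In `exchange-cost` the share spent
    -- outside `Z` cancels against `cost`, and what the ends in `Z` receive is bounded by the
    -- savings.
    star : ∑ₗ (λ S → dA S + 3 * dB S + inner Z S) Z ≤ ∑ₗ (λ S → saving (dA S + dB S)) Z
    star = begin
      ∑ₗ (λ S → dA S + 3 * dB S + inner Z S) Z ≡⟨ ∑ₗ-cong Z (λ {S} _ → gather S) ⟩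
      ∑ₗ (λ S → ∑ (λ v → χ S v * (aa v + 3 * ab v + inn Z v))) Z ≤⟨ ∑ₗ-mono Z (λ {S} S∈Z → ∑χ-mono S (λ v v∈S →
          ≤-trans (gain≥ {v}) (≤-reflexive (cong (_* gain v) (sym (cnt-E (∈⇒cnt>0 S∈Z v∈S))))))) ⟩
      ∑ₗ (λ S → ∑ (λ v → χ S v * (cnt E v * gain v))) Z ≡⟨ ∑ₗ-∑χ Z _ ⟩
      ∑ (λ v → cnt Z v * (cnt E v * gain v)) ≤⟨ +-cancelʳ-≤ costs _ _ balance ⟩
      ∑ₗ (λ S → saving (hits E S)) Z ≡⟨ ∑ₗ-cong Z (λ {S} S∈Z → cong saving (trans
          (∑χ-cong S (λ v v∈S → cnt-E (∈⇒cnt>0 S∈Z v∈S))) (∑χ-distrib-+ S aa ab))) ⟩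
      ∑ₗ (λ S → saving (dA S + dB S)) Z ∎
      where
      open ≤-Reasoning
      costs = ∑ (λ v → cnt E v * cost Z v)
      gather : ∀ S → dA S + 3 * dB S + inner Z S ≡ ∑ (λ v → χ S v * (aa v + 3 * ab v + inn Z v))
      gather S = sym (trans (∑χ-distrib-+ S (λ v → aa v + 3 * ab v) (inn Z)) (cong (_+ inner Z S)
        (trans (∑χ-distrib-+ S aa (λ v → 3 * ab v)) (cong (dA S +_) (∑χ-distribˡ-* S 3 ab)))))
      regroup : ∀ e z g c → e * (z * g + c) ≡ z * (e * g) + e * c
      regroup = solve-∀
      balance : ∑ (λ v → cnt Z v * (cnt E v * gain v)) + costs ≤ ∑ₗ (λ S → saving (hits E S)) Z + costs
      balance = begin
        ∑ (λ v → cnt Z v * (cnt E v * gain v)) + costs ≡⟨ ∑-distrib-+ (λ v → cnt Z v * (cnt E v * gain v)) _ ⟨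
        ∑ (λ v → cnt Z v * (cnt E v * gain v) + cnt E v * cost Z v) ≡⟨ sum-cong-≗ (λ v → regroup (cnt E v) (cnt Z v) (gain v) (cost Z v)) ⟨
        ∑ (λ v → cnt E v * φ v) ≡⟨ ∑ₗ-∑χ E φ ⟨
        ∑ₗ (λ o → ∑ (λ v → χ o v * φ v)) E ≤⟨ ∑ₗ-mono E edge-φ ⟩
        ∑ₗ (λ _ → 4) E ≡⟨ ∑ₗ-cong E (λ o∈E → cong weight (E≡4 o∈E)) ⟨
        ∑ₗ (λ o → weight ∣ o ∣) E ≤⟨ exchange-cost Z fourZ packE ∑E≤k ⟩
        costs + ∑ₗ (λ S → saving (hits E S)) Z ≡⟨ +-comm costs _ ⟩
        ∑ₗ (λ S → saving (hits E S)) Z + costs ∎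

  -- The excess is 2 more for an AB edge, 1 for three and 2 for four AA edges.  As a
  -- connected Z has total inner degree at least 2 (length Z - 1), its excess is at most 2.
  excess : Subset n → ℕ
  excess S = dA S + 3 * dB S + 2 ∸ saving (dA S + dB S)

  excess≡ : ∀ S → excess S + saving (dA S + dB S) ≡ dA S + 3 * dB S + 2
  excess≡ S = m∸n+n≡m (≤-trans (saving≤ (dA S + dB S)) (+-monoˡ-≤ 2 (+-monoʳ-≤ (dA S) (m≤m+n (dB S) _))))

  star-excess : ∀ Z → FourSets Z → AllPairs _≢_ Z → length Z ≤ 4 → ∑ₗ (λ S → excess S + inner Z S) Z ≤ length Z * 2
  star-excess Z fourZ Z≢ Z≤4 = +-cancelʳ-≤ (∑ₗ s Z) _ _ (begin
    ∑ₗ (λ S → excess S + inner Z S) Z + ∑ₗ s Z ≡⟨ ∑ₗ-distrib-+ _ s Z ⟨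
    ∑ₗ (λ S → excess S + inner Z S + s S) Z ≡⟨ ∑ₗ-cong Z (λ {S} _ → trans (shuffle (excess S) (inner Z S) (s S))
        (trans (cong (_+ inner Z S) (excess≡ S)) (shuffle (dA S + 3 * dB S) 2 (inner Z S)))) ⟩
    ∑ₗ (λ S → dA S + 3 * dB S + inner Z S + 2) Z ≡⟨ ∑ₗ-distrib-+ _ (λ _ → 2) Z ⟩
    ∑ₗ (λ S → dA S + 3 * dB S + inner Z S) Z + ∑ₗ (λ _ → 2) Z
      ≤⟨ +-mono-≤ (Centres.star Z fourZ (distinct⇒packed packedP (All.map proj₁ fourZ) Z≢) Z≤4) (≤-reflexive (∑ₗ-const 2 Z)) ⟩
    ∑ₗ s Z + length Z * 2 ≡⟨ +-comm (∑ₗ s Z) _ ⟩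
    length Z * 2 + ∑ₗ s Z ∎)
    where
    open ≤-Reasoning
    s : Subset n → ℕ
    s S = saving (dA S + dB S)
    shuffle : ∀ x y z → x + y + z ≡ x + z + y
    shuffle = solve-∀

-- Discharging

∑≥2⇒points : (f : Fin n → ℕ) → (∀ v → f v ≤ 1) → 2 ≤ ∑ f → ∃₂ λ v u → v ≢ u × 0 < f v × 0 < f u
∑≥2⇒points f f≤1 2≤∑ with ∑-exists f (≤-trans (s≤s z≤n) 2≤∑)
... | v , 0<fv with any? (λ u → ¬? (v ≟ᶠ u) ×-dec 0 <? f u)
...   | yes (u , v≢u , 0<fu) = v , u , v≢u , 0<fv , 0<fu
...   | no none = absurd (≤-trans 2≤∑ (≤-trans (≤-reflexive (∑-supp₁ f v λ x x≢v → n≤0⇒n≡0 (≮⇒≥ λ 0<fx → none (x , x≢v ∘ sym , 0<fx)))) (f≤1 v)))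
                         ≤-refl

saving≤4 : ∀ d → saving d ≤ 4
saving≤4 0 = z≤n
saving≤4 1 = s≤s (s≤s (s≤s z≤n))
saving≤4 (suc (suc d)) = ≤-refl

module Charging {n : ℕ} (I : Instance n) (k : ℕ) (P : List (Subset n)) (packP : Packing I P)
  (opt : LocalOptimum I k P) (100≤k : 100 ≤ k) (O : List (Subset n)) (once : ∀ v → cnt O v ≡ 1)
  (allO : All (λ o → ∣ o ∣ ≤ 4 × (Nonempty o → Available I o)) O) where

  open Local I k P packP opt 100≤k O once allO
  open Mate

  Four : Subset n → Set
  Four S = S ∈ˡ P × ∣ S ∣ ≡ 4

  four-unique : ∀ {S T v} → Four S → Four T → v ∈ S → v ∈ T → S ≡ T
  four-unique (S∈P , _) (T∈P , _) = packed-unique packedP S∈P T∈P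

  -- Uses `saving ≤ 4`, which limits the number of edges; the other bound `saving d ≤ d + 2`
  -- isolates the AB edges in `2dB≤excess`.
  degrees≤ : ∀ S → dA S + 3 * dB S ≤ excess S + 2
  degrees≤ S = +-cancelʳ-≤ 2 _ _ (≤-trans (≤-reflexive (sym (excess≡ S)))
    (≤-trans (+-monoʳ-≤ (excess S) (saving≤4 (dA S + dB S))) (≤-reflexive (sym (+-assoc (excess S) 2 2)))))

  2dB≤excess : ∀ S → 2 * dB S ≤ excess S
  2dB≤excess S = ≤-from (≤-trans (≤-reflexive (sym (excess≡ S))) (+-monoʳ-≤ (excess S) (saving≤ (dA S + dB S))))
                        (lemma (dA S) (dB S) (excess S))
    where lemma : ∀ x y e → 2 * y + (e + (x + y + 2)) ≡ e + (x + 3 * y + 2)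
          lemma = solve-∀

  AB⇒excess : ∀ S → 1 ≤ dB S → 2 ≤ excess S
  AB⇒excess S 1≤dB = ≤-trans (*-monoʳ-≤ 2 1≤dB) (2dB≤excess S)

  dA≤excess+2 : ∀ S → dA S ≤ excess S + 2
  dA≤excess+2 S = ≤-trans (m≤m+n (dA S) _) (degrees≤ S)

  branch⇒excess : ∀ {m} S → 2 + m ≤ dA S → m ≤ excess S
  branch⇒excess {m} S m≤dA = +-cancelʳ-≤ 2 _ _ (≤-trans (≤-reflexive (+-comm m 2)) (≤-trans m≤dA (dA≤excess+2 S)))

  record Link (S T : Subset n) : Set where
    field
      slot : Fin n
      slot∈ : slot ∈ S
      isAA : AASlot slot
      mate∈ : mate slot ∈ T

  open Link

  reverse : ∀ {S T} → Link S T → Link T S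
  reverse l = record { slot = mate (slot l) ; slot∈ = mate∈ l ; isAA = mate-slot (isAA l)
                     ; mate∈ = subst (_∈ _) (sym (mate-mate (isAA l))) (slot∈ l) }

  mate-injective : ∀ {v u} → AASlot v → AASlot u → mate v ≡ mate u → v ≡ u
  mate-injective sv su eq = trans (sym (mate-mate sv)) (trans (cong mate eq) (mate-mate su))

  inn≥1 : ∀ {Z S T} (l : Link S T) → T ∈ˡ Z → 1 ≤ inn Z (slot l)
  inn≥1 {Z} l T∈Z = ≤-trans (∈⇒cnt>0 T∈Z (mate∈ l))
    (≤-reflexive (sym (trans (cong (_* cnt Z (mate (slot l))) (𝟙-yes (AASlot? (slot l)) (isAA l))) (*-identityˡ _))))

  inner≥1 : ∀ {Z S T} → Link S T → T ∈ˡ Z → 1 ≤ inner Z S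
  inner≥1 {Z} {S} l T∈Z = ≤-trans (inn≥1 l T∈Z) (∑χ-point S (inn Z) (slot∈ l))

  inner≥2 : ∀ {Z S T R} (l : Link S T) (m : Link S R) → slot l ≢ slot m → T ∈ˡ Z → R ∈ˡ Z → 2 ≤ inner Z S
  inner≥2 {Z} {S} l m l≢m T∈Z R∈Z = ≤-trans (+-mono-≤ (inn≥1 l T∈Z) (inn≥1 m R∈Z)) (∑χ-two S (inn Z) l≢m (slot∈ l) (slot∈ m))

  slots-differ : ∀ {S T R} → Four T → Four R → (l : Link S T) (m : Link S R) → T ≢ R → slot l ≢ slot m
  slots-differ fT fR l m T≢R l≡m = T≢R (four-unique fT fR (mate∈ l) (subst (λ v → mate v ∈ _) (sym l≡m) (mate∈ m)))

  -- Excess along loops, double edges and paths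

  excess≤2 : ∀ {S} → Four S → excess S ≤ 2
  excess≤2 {S} fS = ≤-trans (≤-trans (m≤m+n _ _) (m≤m+n _ _)) (star-excess (S ∷ []) (fS ∷ []) ([] ∷ []) (s≤s z≤n))

  -- Both ends of the link are inner slots of `S`, which uses up the whole allowance of 2.
  loop : ∀ {S} → Four S → Link S S → excess S ≤ 0
  loop {S} fS l = +-cancelʳ-≤ 2 _ _ (≤-trans (+-monoʳ-≤ (excess S) (inner≥2 {S ∷ []} l (reverse l) (apart (mate-correct (isAA l)) ∘ sym) (here refl) (here refl)))
    (≤-trans (m≤m+n _ _) (star-excess (S ∷ []) (fS ∷ []) ([] ∷ []) (s≤s z≤n))))

  path₂ : ∀ {S T} → Four S → Four T → S ≢ T → Link S T → excess S + excess T ≤ 2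
  path₂ {S} {T} fS fT S≢T l = ≤-from (≤-trans
      (+-mono-≤ (+-monoʳ-≤ (excess S) (inner≥1 {S ∷ T ∷ []} l (there (here refl))))
                (+-monoˡ-≤ 0 (+-monoʳ-≤ (excess T) (inner≥1 {S ∷ T ∷ []} (reverse l) (here refl)))))
      (star-excess (S ∷ T ∷ []) (fS ∷ fT ∷ []) ((S≢T ∷ []) ∷ [] ∷ []) (s≤s (s≤s z≤n))))
    (lemma (excess S) (excess T))
    where lemma : ∀ x y → x + y + 4 ≡ 2 + (x + 1 + (y + 1 + 0))
          lemma = solve-∀

  -- Two parallel links have four inner ends, the whole allowance of two centres.
  double : ∀ {S T} → Four S → Four T → S ≢ T → (l m : Link S T) → slot l ≢ slot m → excess S + excess T ≤ 0
  double {S} {T} fS fT S≢T l m l≢m = ≤-from (≤-trans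
      (+-mono-≤ (+-monoʳ-≤ (excess S) (inner≥2 {S ∷ T ∷ []} l m l≢m (there (here refl)) (there (here refl))))
                (+-monoˡ-≤ 0 (+-monoʳ-≤ (excess T) (inner≥2 {S ∷ T ∷ []} (reverse l) (reverse m)
                  (l≢m ∘ mate-injective (isAA l) (isAA m)) (here refl) (here refl)))))
      (star-excess (S ∷ T ∷ []) (fS ∷ fT ∷ []) ((S≢T ∷ []) ∷ [] ∷ []) (s≤s (s≤s z≤n))))
    (lemma (excess S) (excess T))
    where lemma : ∀ x y → x + y + 4 ≡ 0 + (x + 2 + (y + 2 + 0))
          lemma = solve-∀

  path₃ : ∀ {S T R} → Four S → Four T → Four R → S ≢ T → S ≢ R → T ≢ R → Link T S → Link T R →
          excess S + excess T + excess R ≤ 2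
  path₃ {S} {T} {R} fS fT fR S≢T S≢R T≢R l m = ≤-from (≤-trans
      (+-mono-≤ (+-monoʳ-≤ (excess S) (inner≥1 {Z} (reverse l) T∈))
        (+-mono-≤ (+-monoʳ-≤ (excess T) (inner≥2 {Z} l m (slots-differ fS fR l m S≢R) (here refl) R∈))
          (+-monoˡ-≤ 0 (+-monoʳ-≤ (excess R) (inner≥1 {Z} (reverse m) T∈)))))
      (star-excess Z (fS ∷ fT ∷ fR ∷ []) ((S≢T ∷ S≢R ∷ []) ∷ (T≢R ∷ []) ∷ [] ∷ []) (s≤s (s≤s (s≤s z≤n)))))
    (lemma (excess S) (excess T) (excess R))
    where
    Z = S ∷ T ∷ R ∷ []
    T∈ : T ∈ˡ Z
    T∈ = there (here refl)
    R∈ : R ∈ˡ Z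
    R∈ = there (there (here refl))
    lemma : ∀ x y z → x + y + z + 6 ≡ 2 + (x + 1 + (y + 2 + (z + 1 + 0)))
    lemma = solve-∀

  -- The three links have six ends, leaving 2 of the allowance 8. It serves to keep two `N1` sets
  -- from being the ends of such a path.
  path₄ : ∀ {Q S T R} → Four Q → Four S → Four T → Four R → Q ≢ S → Q ≢ T → Q ≢ R → S ≢ T → S ≢ R → T ≢ R →
          Link S Q → Link S T → Link T R → excess Q + excess S + excess T + excess R ≤ 2
  path₄ {Q} {S} {T} {R} fQ fS fT fR Q≢S Q≢T Q≢R S≢T S≢R T≢R l m r = ≤-from (≤-trans
      (+-mono-≤ (+-monoʳ-≤ (excess Q) (inner≥1 {Z} (reverse l) S∈))
        (+-mono-≤ (+-monoʳ-≤ (excess S) (inner≥2 {Z} l m (slots-differ fQ fT l m Q≢T) (here refl) T∈))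
          (+-mono-≤ (+-monoʳ-≤ (excess T) (inner≥2 {Z} (reverse m) r (slots-differ fS fR (reverse m) r S≢R) S∈ R∈))
            (+-monoˡ-≤ 0 (+-monoʳ-≤ (excess R) (inner≥1 {Z} (reverse r) T∈))))))
      (star-excess Z (fQ ∷ fS ∷ fT ∷ fR ∷ []) ((Q≢S ∷ Q≢T ∷ Q≢R ∷ []) ∷ (S≢T ∷ S≢R ∷ []) ∷ (T≢R ∷ []) ∷ [] ∷ []) ≤-refl))
    (lemma (excess Q) (excess S) (excess T) (excess R))
    where
    Z = Q ∷ S ∷ T ∷ R ∷ []
    S∈ : S ∈ˡ Z
    S∈ = there (here refl)
    T∈ : T ∈ˡ Z
    T∈ = there (there (here refl))
    R∈ : R ∈ˡ Z
    R∈ = there (there (there (here refl)))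
    lemma : ∀ w x y z → w + x + y + z + 8 ≡ 2 + (w + 1 + (x + 2 + (y + 2 + (z + 1 + 0))))
    lemma = solve-∀

  -- In an `N1` set the AB edge takes the whole reserve of 8, leaving nothing for the AA edge. A
  -- `Near` set is an AA neighbour of such a set and makes up for its share.
  N1 Near : Subset n → Set
  N1 S = 1 ≤ dA S × 1 ≤ dB S
  Near S = ∃[ v ] (v ∈ S × AASlot v × N1 (p (mate v)))

  N1? : Decidable N1
  N1? S = 1 ≤? dA S ×-dec 1 ≤? dB S

  Mid? : Decidable (λ S → 3 ≤ dA S ⊎ Near S)
  Mid? S = 3 ≤? dA S ⊎-dec any? (λ v → v ∈? S ×-dec (AASlot? v ×-dec N1? (p (mate v))))

  -- A 4-set short of value draws on its neighbours of lower level.  One with both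
  -- kinds of edges lacks 3, more than its only AA neighbour can spare, so that
  -- neighbour is in turn put on level 1 to draw on the next 4-set.
  data LevelView (S : Subset n) : ℕ → Set where
    top : N1 S → LevelView S 4
    mid : ¬ N1 S → 3 ≤ dA S ⊎ Near S → LevelView S 1
    low : ¬ N1 S → ¬ (3 ≤ dA S ⊎ Near S) → LevelView S 0

  levelView : ∀ S → ∃[ m ] LevelView S m
  levelView S = case N1? S of λ where
    (yes n1) → 4 , top n1
    (no ¬n1) → case Mid? S of λ where
      (yes m) → 1 , mid ¬n1 m
      (no ¬m) → 0 , low ¬n1 ¬m

  level : Subset n → ℕ
  level S = proj₁ (levelView S)

  level≡4 : ∀ {S} → N1 S → level S ≡ 4
  level≡4 {S} n1 with levelView S
  ... | _ , top _ = refl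
  ... | _ , mid ¬n1 _ = contradiction n1 ¬n1
  ... | _ , low ¬n1 _ = contradiction n1 ¬n1

  level≤1 : ∀ {S} → ¬ N1 S → level S ≤ 1
  level≤1 {S} ¬n1 with levelView S
  ... | _ , top n1 = contradiction n1 ¬n1
  ... | _ , mid _ _ = ≤-refl
  ... | _ , low _ _ = z≤n

  level≡1 : ∀ {S} → ¬ N1 S → 3 ≤ dA S ⊎ Near S → level S ≡ 1
  level≡1 {S} ¬n1 m with levelView S
  ... | _ , top n1 = contradiction n1 ¬n1
  ... | _ , mid _ _ = refl
  ... | _ , low _ ¬m = contradiction m ¬m

  level≤0 : ∀ {S} → ¬ N1 S → ¬ (3 ≤ dA S ⊎ Near S) → level S ≤ 0
  level≤0 {S} ¬n1 ¬m with levelView S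
  ... | _ , top n1 = contradiction n1 ¬n1
  ... | _ , mid _ m = contradiction m ¬m
  ... | _ , low _ _ = z≤n

  -- An AA edge needs 26 = 13 + 13, and the level difference moves value from one end to the other.
  -- An AB edge needs 26 = 18 + 8, where 8 is the value in the 3-set.
  val : Fin n → ℕ
  val v = case AASlot? v of λ where
    (yes _) → 13 + level (p (mate v)) ∸ level (p v)
    (no _) → case ABSlot? v of λ where
      (yes _) → 18
      (no _) → 10 * a v + 8 * b v

  val-AA : ∀ {v} → AASlot v → val v ≡ 13 + level (p (mate v)) ∸ level (p v)
  val-AA {v} s with AASlot? v
  ... | yes _ = refl
  ... | no ¬s = contradiction s ¬s

  val-AB : ∀ {v} → ABSlot v → val v ≡ 18
  val-AB {v} t with AASlot? v
  ... | yes s = contradiction (proj₂ t) (AA⇒¬AB (proj₂ s))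
  ... | no _ with ABSlot? v
  ...   | yes _ = refl
  ...   | no ¬t = contradiction t ¬t

  val-free : ∀ {v} → ¬ AASlot v → ¬ ABSlot v → val v ≡ 10 * a v + 8 * b v
  val-free {v} ¬s ¬t with AASlot? v
  ... | yes s = contradiction s ¬s
  ... | no _ with ABSlot? v
  ...   | yes t = contradiction t ¬t
  ...   | no _ = refl

  aa≡1 : ∀ {v} → AASlot v → aa v ≡ 1
  aa≡1 {v} = 𝟙-yes (AASlot? v)

  -- All elements are worth 10, an AB slot 18 - 10 = 8 more and an AA slot at most `F` more. To stay
  -- within 48, the extras must not exceed 8.
  charge : ∀ {S} → Four S → (F : Fin n → ℕ) → (∀ v → v ∈ S → AASlot v → val v ≤ 10 + F v) →
           ∑ (λ v → χ S v * val v) ≤ 40 + (8 * dB S + ∑ (λ v → χ S v * (aa v * F v)))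
  charge {S} (S∈P , S≡4) F bound = begin
    ∑ (λ v → χ S v * val v) ≤⟨ ∑χ-mono S pointwise ⟩
    ∑ (λ v → χ S v * (10 + (8 * ab v + aa v * F v))) ≡⟨ ∑χ-distrib-+ S (λ _ → 10) _ ⟩
    ∑ (λ v → χ S v * 10) + ∑ (λ v → χ S v * (8 * ab v + aa v * F v))
      ≡⟨ cong₂ _+_ (trans (∑χ-const S 10) (cong (10 *_) S≡4))
                   (trans (∑χ-distrib-+ S (λ v → 8 * ab v) _) (cong (_+ ∑ (λ v → χ S v * (aa v * F v))) (∑χ-distribˡ-* S 8 ab))) ⟩
    40 + (8 * dB S + ∑ (λ v → χ S v * (aa v * F v))) ∎
    where
    open ≤-Reasoning
    pointwise : ∀ v → v ∈ S → val v ≤ 10 + (8 * ab v + aa v * F v)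
    pointwise v v∈S = case AASlot? v of λ where
      (yes s) → ≤-trans (bound v v∈S s) (+-monoʳ-≤ 10 (≤-trans (≤-reflexive (sym (trans (cong (_* F v) (aa≡1 s)) (*-identityˡ (F v)))))
                  (m≤n+m _ (8 * ab v))))
      (no ¬s) → case ABSlot? v of λ where
        (yes t) → ≤-trans (≤-reflexive (val-AB t)) (+-monoʳ-≤ 10 (≤-trans (*-monoʳ-≤ 8 (≤-reflexive (sym (𝟙-yes (ABSlot? v) t)))) (m≤m+n _ _)))
        (no ¬t) → let a≡1 , b≡0 = a-four S∈P S≡4 v∈S in
          ≤-trans (≤-reflexive (trans (val-free ¬s ¬t) (cong₂ (λ x y → 10 * x + 8 * y) a≡1 b≡0))) (m≤m+n 10 _)

  charge-const : ∀ {S} → Four S → (c : ℕ) → (∀ v → v ∈ S → AASlot v → val v ≤ 10 + c) →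
                 ∑ (λ v → χ S v * val v) ≤ 40 + (8 * dB S + c * dA S)
  charge-const {S} fS c bound = ≤-trans (charge fS (λ _ → c) bound) (≤-reflexive (cong (λ x → 40 + (8 * dB S + x))
    (trans (∑χ-cong S (λ v _ → *-comm (aa v) c)) (∑χ-distribˡ-* S c aa))))

  val≤ : ∀ {S v x y c} → Four S → v ∈ S → AASlot v → level (p (mate v)) ≤ x → y ≤ level S → 13 + x ≤ c + y → val v ≤ c
  val≤ {S} {v} {x} {y} {c} (S∈P , _) v∈S s lx ly le = begin
    val v ≡⟨ val-AA s ⟩
    13 + level (p (mate v)) ∸ level (p v) ≡⟨ cong (λ T → 13 + level (p (mate v)) ∸ level T) (p≡ S∈P v∈S) ⟩
    13 + level (p (mate v)) ∸ level S ≤⟨ ∸-mono (+-monoʳ-≤ 13 lx) ly ⟩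
    13 + x ∸ y ≤⟨ ∸-monoˡ-≤ y le ⟩
    c + y ∸ y ≡⟨ m+n∸n≡m c y ⟩
    c ∎
    where open ≤-Reasoning

  neighbour : ∀ {v} → AASlot v → Four (p (mate v))
  neighbour {v} s = let p∈P , p≡4 , _ = a≡1⇒p (mate v) (proj₁ (mate-slot s)) in p∈P , p≡4

  link : ∀ {S v} → v ∈ S → AASlot v → Link S (p (mate v))
  link {v = v} v∈S s = record { slot = v ; slot∈ = v∈S ; isAA = s
                              ; mate∈ = proj₂ (proj₂ (a≡1⇒p (mate v) (proj₁ (mate-slot s)))) }

  dA≥2 : ∀ {S v u} → v ≢ u → v ∈ S → u ∈ S → AASlot v → AASlot u → 2 ≤ dA S
  dA≥2 {S} v≢u v∈S u∈S s t = subst₂ (λ x y → x + y ≤ dA S) (aa≡1 s) (aa≡1 t) (∑χ-two S aa v≢u v∈S u∈S)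

  dA≥1 : ∀ {S v} → v ∈ S → AASlot v → 1 ≤ dA S
  dA≥1 {S} v∈S s = subst (_≤ dA S) (aa≡1 s) (∑χ-point S aa v∈S)

  two-slots : ∀ {S} → 2 ≤ dA S → ∃₂ λ v u → v ≢ u × (v ∈ S × AASlot v) × (u ∈ S × AASlot u)
  two-slots {S} 2≤dA with ∑≥2⇒points (λ v → χ S v * aa v) (λ v → *-mono-≤ (χ≤1 S v) (𝟙≤1 (AASlot? v))) 2≤dA
  ... | v , u , v≢u , 0<v , 0<u = v , u , v≢u , point v 0<v , point u 0<u
    where
    point : ∀ v → 0 < χ S v * aa v → v ∈ S × AASlot v
    point v 0< = let v∈S , aa≡1 = χ*≡1 S v (≤-antisym (*-mono-≤ (χ≤1 S v) (𝟙≤1 (AASlot? v))) 0<) in v∈S , 𝟙≡1 (AASlot? v) aa≡1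

  N1⇒dA≤1 : ∀ {S} → Four S → 1 ≤ dB S → dA S ≤ 1
  N1⇒dA≤1 {S} fS 1≤dB = +-cancelʳ-≤ 3 _ _ (≤-trans (+-monoʳ-≤ (dA S) (*-monoʳ-≤ 3 1≤dB))
    (≤-trans (degrees≤ S) (+-monoˡ-≤ 2 (excess≤2 fS))))

  N1⇒excess : ∀ {S} → N1 S → 2 ≤ excess S
  N1⇒excess {S} (_ , 1≤dB) = AB⇒excess S 1≤dB

  -- The AB edge takes the 8, so an AA slot has to stay at 10 = 13 + 1 - 4. This fails only for a
  -- neighbour in `N1`, but two adjacent sets with AB edges would have total excess 4, and a loop
  -- allows no excess.
  charge-AB : ∀ {S} → Four S → 1 ≤ dB S → ∑ (λ v → χ S v * val v) ≤ 48
  charge-AB {S} fS 1≤dB = ≤-trans (charge-const fS 0 bound) (+-monoʳ-≤ 40 (≤-trans (≤-reflexive (+-identityʳ _)) (*-monoʳ-≤ 8 dB≤1)))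
    where
    2≤ex = AB⇒excess S 1≤dB
    dB≤1 : dB S ≤ 1
    dB≤1 = *-cancelˡ-≤ 2 (≤-trans (2dB≤excess S) (excess≤2 fS))
    bound : ∀ v → v ∈ S → AASlot v → val v ≤ 10 + 0
    bound v v∈S s = val≤ fS v∈S s (level≤1 ¬N1T) (≤-reflexive (sym (level≡4 (dA≥1 v∈S s , 1≤dB)))) ≤-refl
      where
      T = p (mate v)
      l = link v∈S s
      ¬N1T : ¬ N1 T
      ¬N1T n1 with S ≟ˢ T
      ... | yes S≡T = absurd (loop fS (subst (Link S) (sym S≡T) l)) (≤-trans (s≤s z≤n) 2≤ex)
      ... | no S≢T = absurd (path₂ fS (neighbour s) S≢T l) (≤-trans (s≤s (s≤s (s≤s z≤n))) (+-mono-≤ 2≤ex (N1⇒excess n1)))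

  -- Three AA slots worth 13 exceed the limit by 1. The excess of at least 1 at `S` leaves too
  -- little for an `N1` set at distance one or two, so a neighbour has level 0 unless it branches as
  -- well.
  module Branching {S} (fS : Four S) (¬AB : ¬ 1 ≤ dB S) (3≤dA : 3 ≤ dA S) where

    1≤ex : 1 ≤ excess S
    1≤ex = branch⇒excess S 3≤dA

    ¬N1S : ¬ N1 S
    ¬N1S = ¬AB ∘ proj₂

    1≤level : 1 ≤ level S
    1≤level = ≤-reflexive (sym (level≡1 ¬N1S (inj₁ 3≤dA)))

    module _ {v} (v∈S : v ∈ S) (s : AASlot v) where
      T = p (mate v)
      fT = neighbour s
      l : Link S T
      l = link v∈S s

      S≢T : S ≢ T
      S≢T S≡T = absurd (loop fS (subst (Link S) (sym S≡T) l)) 1≤ex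

      ¬N1T : ¬ N1 T
      ¬N1T n1 = absurd (path₂ fS fT S≢T l) (+-mono-≤ 1≤ex (N1⇒excess n1))

      ¬NearT : ¬ Near T
      ¬NearT (w , w∈T , t , n1) = absurd (path₃ fS fT (neighbour t) S≢T S≢R T≢R (reverse l) (link w∈T t))
          (+-mono-≤ (≤-trans 1≤ex (m≤m+n _ _)) (N1⇒excess n1))
        where
        S≢R : S ≢ p (mate w)
        S≢R S≡R = ¬N1S (subst N1 (sym S≡R) n1)
        T≢R : T ≢ p (mate w)
        T≢R T≡R = ¬N1T (subst N1 (sym T≡R) n1)

      val≤13 : val v ≤ 13
      val≤13 = val≤ fS v∈S s (level≤1 ¬N1T) 1≤level ≤-refl

      val≤12 : ¬ 3 ≤ dA T → val v ≤ 12
      val≤12 3≰ = val≤ fS v∈S s (level≤0 ¬N1T [ 3≰ , ¬NearT ]′) 1≤level ≤-refl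

    -- All four slots must be worth 12. Here the excess of `S` is already 2, so no neighbour
    -- branches.
    charge-four : 4 ≤ dA S → ∑ (λ v → χ S v * val v) ≤ 48
    charge-four 4≤dA = ≤-trans (charge-const fS 2 bound)
        (+-monoʳ-≤ 40 (+-mono-≤ (*-monoʳ-≤ 8 (≮⇒≥ ¬AB)) (*-monoʳ-≤ 2 (≤-trans (dA≤excess+2 S) (+-monoˡ-≤ 2 (excess≤2 fS))))))
      where
      bound : ∀ v → v ∈ S → AASlot v → val v ≤ 12
      bound v v∈S s = val≤12 v∈S s λ 3≤dAT → absurd (path₂ fS (fT v∈S s) (S≢T v∈S s) (l v∈S s))
        (+-mono-≤ (branch⇒excess S 4≤dA) (branch⇒excess (T v∈S s) 3≤dAT))

    -- One slot worth 12 suffices: 12 + 13 + 13 + 10 = 48. Two slots need inspection: if both lead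
    -- to branching neighbours, these form with `S` a path of total excess 3, or coincide and form a
    -- double edge, which allows no excess.
    charge-three : dA S ≡ 3 → ∑ (λ v → χ S v * val v) ≤ 48
    charge-three dA≡3 with two-slots {S} (≤-trans (s≤s (s≤s z≤n)) 3≤dA)
    ... | v₁ , v₂ , v₁≢v₂ , (∈₁ , s₁) , (∈₂ , s₂) = case 3 ≤? dA (T ∈₁ s₁) of λ where
        (no 3≰) → cheap v₁ ∈₁ s₁ 3≰
        (yes 3≤₁) → case 3 ≤? dA (T ∈₂ s₂) of λ where
          (no 3≰) → cheap v₂ ∈₂ s₂ 3≰
          (yes 3≤₂) → case T ∈₁ s₁ ≟ˢ T ∈₂ s₂ of λ where
            (yes T≡T′) → absurd (double fS (fT ∈₁ s₁) (S≢T ∈₁ s₁) (l ∈₁ s₁) (subst (λ R → Link S R) (sym T≡T′) (l ∈₂ s₂)) (differ T≡T′))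
                           (≤-trans 1≤ex (m≤m+n _ _))
            (no T≢T′) → absurd (path₃ (fT ∈₁ s₁) fS (fT ∈₂ s₂) (S≢T ∈₁ s₁ ∘ sym) T≢T′ (S≢T ∈₂ s₂) (l ∈₁ s₁) (l ∈₂ s₂))
                           (+-mono-≤ (+-mono-≤ (branch⇒excess (T ∈₁ s₁) 3≤₁) 1≤ex) (branch⇒excess (T ∈₂ s₂) 3≤₂))
      where
      differ : (T≡T′ : T ∈₁ s₁ ≡ T ∈₂ s₂) → slot (l ∈₁ s₁) ≢ slot (subst (λ R → Link S R) (sym T≡T′) (l ∈₂ s₂))
      differ T≡T′ eq = v₁≢v₂ (trans eq (slot-subst (sym T≡T′)))
        where slot-subst : ∀ {R R′} {m : Link S R} (R≡R′ : R ≡ R′) → slot (subst (λ R → Link S R) R≡R′ m) ≡ slot m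
              slot-subst refl = refl
      cheap : ∀ v₀ (∈₀ : v₀ ∈ S) (s₀ : AASlot v₀) → ¬ 3 ≤ dA (T ∈₀ s₀) → ∑ (λ v → χ S v * val v) ≤ 48
      cheap v₀ ∈₀ s₀ 3≰ = ≤-trans (charge fS F bound) (+-monoʳ-≤ 40 (+-mono-≤ (*-monoʳ-≤ 8 (≮⇒≥ ¬AB)) total))
        where
        δ F : Fin n → ℕ
        δ v = 𝟙 (v ≟ᶠ v₀)
        F v = 3 ∸ δ v
        bound : ∀ v → v ∈ S → AASlot v → val v ≤ 10 + F v
        bound v v∈S s with v ≟ᶠ v₀
        ... | yes refl = val≤12 v∈S s 3≰
        ... | no _ = val≤13 v∈S s
        merge : ∀ v → aa v * F v + δ v ≤ 3 * aa v
        merge v with v ≟ᶠ v₀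
        ... | yes refl = ≤-reflexive (trans (cong (λ x → x * 2 + 1) (aa≡1 s₀)) (cong (3 *_) (sym (aa≡1 s₀))))
        ... | no _ = ≤-reflexive (trans (+-identityʳ _) (*-comm (aa v) 3))
        total : ∑ (λ v → χ S v * (aa v * F v)) ≤ 8
        total = +-cancelʳ-≤ 1 _ _ (begin
          ∑ (λ v → χ S v * (aa v * F v)) + 1 ≤⟨ +-monoʳ-≤ _ (≤-trans (≤-reflexive (sym (𝟙-yes (v₀ ≟ᶠ v₀) refl))) (∑χ-point S δ ∈₀)) ⟩
          ∑ (λ v → χ S v * (aa v * F v)) + ∑ (λ v → χ S v * δ v) ≡⟨ ∑χ-distrib-+ S (λ v → aa v * F v) δ ⟨
          ∑ (λ v → χ S v * (aa v * F v + δ v)) ≤⟨ ∑χ-mono S (λ v _ → merge v) ⟩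
          ∑ (λ v → χ S v * (3 * aa v)) ≡⟨ ∑χ-distribˡ-* S 3 aa ⟩
          3 * dA S ≡⟨ cong (3 *_) dA≡3 ⟩
          9 ∎)
          where open ≤-Reasoning

  -- Without an `N1` neighbour a slot is worth at most 13 + 1 - 0 = 14, and 14 + 14 + 20 = 48.
  charge-far : ∀ {S} → Four S → ¬ 1 ≤ dB S → dA S ≤ 2 → ¬ Near S → ∑ (λ v → χ S v * val v) ≤ 48
  charge-far {S} fS ¬AB dA≤2 ¬near = ≤-trans (charge-const fS 4 bound)
      (+-monoʳ-≤ 40 (+-mono-≤ (*-monoʳ-≤ 8 (≮⇒≥ ¬AB)) (*-monoʳ-≤ 4 dA≤2)))
    where
    bound : ∀ v → v ∈ S → AASlot v → val v ≤ 14
    bound v v∈S s = val≤ fS v∈S s (level≤1 (λ n1 → ¬near (v , v∈S , s , n1))) z≤n ≤-refl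

  -- The slot towards the `N1` set `Q` is worth 13 + 4 - 1 = 16, leaving 12 = 13 + 0 - 1 for a
  -- second AA slot. So the neighbour `T` there has to be on level 0.
  charge-near : ∀ {S} → Four S → ¬ 1 ≤ dB S → dA S ≤ 2 → Near S → ∑ (λ v → χ S v * val v) ≤ 48
  charge-near {S} fS ¬AB dA≤2 near@(v₀ , ∈₀ , s₀ , n1Q) = ≤-trans (charge fS F bound)
      (+-monoʳ-≤ 40 (+-mono-≤ (*-monoʳ-≤ 8 (≮⇒≥ ¬AB)) total))
    where
    Q = p (mate v₀)
    fQ = neighbour s₀
    m : Link S Q
    m = link ∈₀ s₀
    ¬N1S : ¬ N1 S
    ¬N1S = ¬AB ∘ proj₂
    1≤level : 1 ≤ level S
    1≤level = ≤-reflexive (sym (level≡1 ¬N1S (inj₂ near)))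
    2≤ex = N1⇒excess n1Q
    Q≢S : Q ≢ S
    Q≢S Q≡S = ¬N1S (subst N1 Q≡S n1Q)

    δ F : Fin n → ℕ
    δ v = 𝟙 (v ≟ᶠ v₀)
    F v = 2 + 4 * δ v

    module _ {v} (v∈S : v ∈ S) (s : AASlot v) (v≢v₀ : v ≢ v₀) where
      T = p (mate v)
      fT = neighbour s
      l : Link S T
      l = link v∈S s

      -- A loop would make `v`, `mate v` and `v₀` three AA slots of `S`.
      T≢S : T ≢ S
      T≢S T≡S = absurd dA≤2 (subst₂ _≤_ (cong₂ _+_ (cong₂ _+_ (aa≡1 s) (aa≡1 (mate-slot s))) (aa≡1 s₀)) refl
        (∑χ-three S aa (apart (mate-correct s) ∘ sym) v≢v₀ mate≢v₀ v∈S mate∈S ∈₀))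
        where
        mate∈S : mate v ∈ S
        mate∈S = subst (mate v ∈_) T≡S (mate∈ l)
        mate≢v₀ : mate v ≢ v₀
        mate≢v₀ eq = Q≢S (four-unique fQ fS (mate∈ m) (subst (_∈ S) (trans (sym (mate-mate s)) (cong mate eq)) v∈S))

      Q≢T : Q ≢ T
      Q≢T Q≡T = absurd (double fS fQ (Q≢S ∘ sym) m parallel (v≢v₀ ∘ sym)) (≤-trans (≤-trans (s≤s z≤n) 2≤ex) (m≤n+m _ _))
        where
        parallel : Link S Q
        parallel = record { slot = v ; slot∈ = v∈S ; isAA = s ; mate∈ = subst (mate v ∈_) (sym Q≡T) (mate∈ l) }

      light : ¬ 1 ≤ excess T
      light 1≤exT = absurd (path₃ fQ fS fT Q≢S Q≢T (T≢S ∘ sym) m l)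
        (+-mono-≤ (≤-trans 2≤ex (m≤m+n _ _)) 1≤exT)

      ¬N1T : ¬ N1 T
      ¬N1T n1 = light (≤-trans (s≤s z≤n) (N1⇒excess n1))

      ¬NearT : ¬ Near T
      ¬NearT (w , w∈T , t , n1) = case Q ≟ˢ R of λ where
          -- A common `N1` neighbour of `S` and `T` would have two AA edges besides its AB edge.
          (yes Q≡R) → absurd (N1⇒dA≤1 fQ (proj₂ n1Q))
            (dA≥2 (λ eq → T≢S (four-unique fT fS w∈T (subst (_∈ S) (mate-injective s₀ t eq) ∈₀)))
                  (mate∈ m) (subst (mate w ∈_) (sym Q≡R) (mate∈ r)) (mate-slot s₀) (mate-slot t))
          -- Otherwise the path Q, S, T, R has excess at least 2 at both ends.
          (no Q≢R) → absurd (path₄ fQ fS fT fR Q≢S Q≢T Q≢R (T≢S ∘ sym) S≢R T≢R m l r)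
            (+-mono-≤ (≤-trans (s≤s z≤n) (≤-trans 2≤ex (≤-trans (m≤m+n _ _) (m≤m+n _ _)))) (N1⇒excess n1))
        where
        R = p (mate w)
        fR = neighbour t
        r : Link T R
        r = link w∈T t
        S≢R : S ≢ R
        S≢R S≡R = ¬N1S (subst N1 (sym S≡R) n1)
        T≢R : T ≢ R
        T≢R T≡R = ¬N1T (subst N1 (sym T≡R) n1)

      val≤12 : val v ≤ 12
      val≤12 = val≤ fS v∈S s (level≤0 ¬N1T [ light ∘ branch⇒excess T , ¬NearT ]′) 1≤level ≤-refl

    bound : ∀ v → v ∈ S → AASlot v → val v ≤ 10 + F v
    bound v v∈S s with v ≟ᶠ v₀
    ... | yes refl = val≤ fS v∈S s (≤-reflexive (level≡4 n1Q)) 1≤level ≤-refl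
    ... | no v≢v₀ = val≤12 v∈S s v≢v₀

    merge : ∀ v → aa v * F v ≤ 2 * aa v + 4 * δ v
    merge v with v ≟ᶠ v₀
    ... | yes refl = ≤-reflexive (trans (cong (_* 6) (aa≡1 s₀)) (cong (λ x → 2 * x + 4) (sym (aa≡1 s₀))))
    ... | no _ = ≤-reflexive (trans (*-comm (aa v) 2) (sym (+-identityʳ _)))

    δ-once : ∑ (λ v → χ S v * δ v) ≤ 1
    δ-once = ≤-trans (≤-reflexive (∑-supp₁ (λ v → χ S v * δ v) v₀ (λ x x≢ → trans (cong (χ S x *_) (𝟙-no (x ≟ᶠ v₀) x≢)) (*-zeroʳ (χ S x)))))
      (*-mono-≤ (χ≤1 S v₀) (𝟙≤1 (v₀ ≟ᶠ v₀)))

    total : ∑ (λ v → χ S v * (aa v * F v)) ≤ 8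
    total = begin
      ∑ (λ v → χ S v * (aa v * F v)) ≤⟨ ∑χ-mono S (λ v _ → merge v) ⟩
      ∑ (λ v → χ S v * (2 * aa v + 4 * δ v)) ≡⟨ ∑χ-distrib-+ S (λ v → 2 * aa v) _ ⟩
      ∑ (λ v → χ S v * (2 * aa v)) + ∑ (λ v → χ S v * (4 * δ v)) ≡⟨ cong₂ _+_ (∑χ-distribˡ-* S 2 aa) (∑χ-distribˡ-* S 4 δ) ⟩
      2 * dA S + 4 * ∑ (λ v → χ S v * δ v) ≤⟨ +-mono-≤ (*-monoʳ-≤ 2 dA≤2) (*-monoʳ-≤ 4 δ-once) ⟩
      8 ∎
      where open ≤-Reasoning

  charge-4set : ∀ {S} → Four S → ∑ (λ v → χ S v * val v) ≤ 48
  charge-4set {S} fS = case 1 ≤? dB S of λ where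
    (yes 1≤dB) → charge-AB fS 1≤dB
    (no ¬AB) → case 3 ≤? dA S of λ where
      (yes 3≤dA) → case 4 ≤? dA S of λ where
        (yes 4≤dA) → Branching.charge-four fS ¬AB 3≤dA 4≤dA
        (no 4≰dA) → Branching.charge-three fS ¬AB 3≤dA (≤-antisym (≤-pred (≰⇒> 4≰dA)) 3≤dA)
      (no 3≰dA) → case any? (λ v → v ∈? S ×-dec (AASlot? v ×-dec N1? (p (mate v)))) of λ where
        (yes near) → charge-near fS ¬AB (≤-pred (≰⇒> 3≰dA)) near
        (no ¬near) → charge-far fS ¬AB (≤-pred (≰⇒> 3≰dA)) ¬near

  charge-3set : ∀ {S} → S ∈ˡ P → ∣ S ∣ ≡ 3 → ∑ (λ v → χ S v * val v) ≤ 24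
  charge-3set {S} S∈P S≡3 = ≤-trans (∑χ-mono S (λ v v∈S → ≤-reflexive (val≡8 v∈S)))
      (≤-reflexive (trans (∑χ-const S 8) (cong (8 *_) S≡3)))
    where
    val≡8 : ∀ {v} → v ∈ S → val v ≡ 8
    val≡8 {v} v∈S = let a≡0 , b≡1 = a-three S∈P S≡3 v∈S in
      trans (val-free (λ s → case trans (sym a≡0) (proj₁ s) of λ ()) (λ t → case trans (sym a≡0) (proj₁ t) of λ ()))
            (cong₂ (λ x y → 10 * x + 8 * y) a≡0 b≡1)

  -- What the sets of the optimum collect

  level≤4 : ∀ S → level S ≤ 4
  level≤4 S with levelView S
  ... | _ , top _ = ≤-refl
  ... | _ , mid _ _ = s≤s z≤n
  ... | _ , low _ _ = z≤n

  -- Even the cheapest AA slot, in an `N1` set next to a set of level 0, is worth 13 - 4 = 9.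
  val≥ : ∀ v → 8 * (a v + b v) ≤ val v
  val≥ v = case AASlot? v of λ where
    (yes s) → ≤-trans (≤-reflexive (cong₂ (λ x y → 8 * (x + y)) (proj₁ s) (a≡1⇒b≡0 v (proj₁ s))))
      (≤-trans (n≤1+n 8) (≤-trans (∸-mono (m≤m+n 13 (level (p (mate v)))) (level≤4 (p v))) (≤-reflexive (sym (val-AA s)))))
    (no ¬s) → case ABSlot? v of λ where
      (yes t) → ≤-trans (≤-reflexive (cong₂ (λ x y → 8 * (x + y)) (proj₁ t) (a≡1⇒b≡0 v (proj₁ t))))
        (≤-trans (m≤m+n 8 10) (≤-reflexive (sym (val-AB t))))
      (no ¬t) → ≤-trans (≤-reflexive (*-distribˡ-+ 8 (a v) (b v))) (≤-trans (+-monoˡ-≤ (8 * b v) (*-monoˡ-≤ (a v) (m≤m+n 8 2)))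
        (≤-reflexive (sym (val-free ¬s ¬t))))

  earn-3set : ∀ {o} → o ∈ˡ O → ∣ o ∣ ≡ 3 → 2 ≤ ∑ (λ v → χ o v * val v)
  earn-3set {o} o∈O o≡3 = begin
    2 ≤⟨ m≤m+n 2 6 ⟩
    8 * 1 ≤⟨ *-monoʳ-≤ 8 (nonzero (i o) (j o) (subst (λ m → weight m ≤ 3 * i o + j o) o≡3 (weight≤3i+j o∈O (≤-reflexive (sym o≡3))))) ⟩
    8 * (i o + j o) ≡⟨ cong (8 *_) (∑χ-distrib-+ o a b) ⟨
    8 * ∑ (λ v → χ o v * (a v + b v)) ≡⟨ ∑χ-distribˡ-* o 8 _ ⟨
    ∑ (λ v → χ o v * (8 * (a v + b v))) ≤⟨ ∑χ-mono o (λ v _ → val≥ v) ⟩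
    ∑ (λ v → χ o v * val v) ∎
    where
    open ≤-Reasoning
    nonzero : ∀ x y → 1 ≤ 3 * x + y → 1 ≤ x + y
    nonzero zero y 1≤ = 1≤
    nonzero (suc x) y _ = s≤s z≤n

  earn-AA : ∀ {o} → o ∈ˡ O → AASet o → 26 ≤ ∑ (λ v → χ o v * val v)
  earn-AA {o} o∈O aao@(_ , i≡2 , _) with ∑≡2⇒points (λ v → χ o v * a v) (λ v → *-mono-≤ (χ≤1 o v) (a≤1 v)) i≡2
  ... | v , u , v≢u , χa≡1 , _ with χ*≡1 o v χa≡1
  ...   | v∈o , a≡1 with find-∈ packedO o∈O v∈o
  ...     | refl = begin
    26 ≤⟨ cancel (level (p (mate v))) (level (p v)) ⟩
    (13 + level (p (mate v)) ∸ level (p v)) + (13 + level (p v) ∸ level (p (mate v)))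
      ≡⟨ cong₂ _+_ (val-AA s) (trans (val-AA (mate-slot s)) (cong (λ x → 13 + level (p x) ∸ level (p (mate v))) (mate-mate s))) ⟨
    val v + val (mate v) ≤⟨ ∑χ-two (q v) val (apart (mate-correct s) ∘ sym) (v∈q v) (u∈q (mate-correct s)) ⟩
    ∑ (λ x → χ (q v) x * val x) ∎
    where
    open ≤-Reasoning
    s : AASlot v
    s = a≡1 , aao
    -- Truncation in `∸` can only enlarge the sum, so it needs no case distinction.
    cancel : ∀ x y → 26 ≤ (13 + x ∸ y) + (13 + y ∸ x)
    cancel x y = ≤-from (+-mono-≤ (m≤n+m∸n (13 + x) y) (m≤n+m∸n (13 + y) x)) (lemma x y (13 + x ∸ y) (13 + y ∸ x))
      where lemma : ∀ x y c d → 26 + ((y + c) + (x + d)) ≡ c + d + (13 + x + (13 + y))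
            lemma = solve-∀

  earn-AB : ∀ {o} → o ∈ˡ O → ABSet o → 26 ≤ ∑ (λ v → χ o v * val v)
  earn-AB {o} o∈O abo@(_ , i≡1 , j≡1) with ∑≡1⇒point (λ v → χ o v * a v) i≡1 | ∑≡1⇒point (λ v → χ o v * b v) j≡1
  ... | v , χa≡1 , _ | u , χb≡1 , _ with χ*≡1 o v χa≡1 | χ*≡1 o u χb≡1
  ...   | v∈o , a≡1 | u∈o , b≡1 with find-∈ packedO o∈O v∈o
  ...     | refl = begin
    18 + 8 ≤⟨ +-mono-≤ (≤-reflexive (sym (val-AB (a≡1 , abo)))) (≤-trans (*-monoʳ-≤ 8 (≤-trans (≤-reflexive (sym b≡1)) (m≤n+m (b u) (a u)))) (val≥ u)) ⟩
    val v + val u ≤⟨ ∑χ-two (q v) val v≢u v∈o u∈o ⟩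
    ∑ (λ x → χ (q v) x * val x) ∎
    where
    open ≤-Reasoning
    v≢u : v ≢ u
    v≢u refl = case trans (sym b≡1) (a≡1⇒b≡0 v a≡1) of λ ()

  earn-other : ∀ {o} → o ∈ˡ O → ∣ o ∣ ≡ 4 → ¬ AASet o → ¬ ABSet o → 26 ≤ ∑ (λ v → χ o v * val v)
  earn-other {o} o∈O o≡4 ¬aa ¬ab = begin
    26 ≤⟨ cases (i o) (j o) (subst (λ m → weight m ≤ 3 * i o + j o) o≡4 (weight≤3i+j o∈O (≤-trans (n≤1+n 3) (≤-reflexive (sym o≡4)))))
            (λ i≡2 j≡0 → ¬aa (o≡4 , i≡2 , j≡0)) (λ i≡1 j≡1 → ¬ab (o≡4 , i≡1 , j≡1)) ⟩
    10 * i o + 8 * j o ≡⟨ cong₂ _+_ (∑χ-distribˡ-* o 10 a) (∑χ-distribˡ-* o 8 b) ⟨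
    ∑ (λ v → χ o v * (10 * a v)) + ∑ (λ v → χ o v * (8 * b v)) ≡⟨ ∑χ-distrib-+ o (λ v → 10 * a v) _ ⟨
    ∑ (λ v → χ o v * (10 * a v + 8 * b v)) ≡⟨ ∑χ-cong o (λ v v∈o → val-free
        (λ s → ¬aa (subst AASet (find-∈ packedO o∈O v∈o) (proj₂ s))) (λ t → ¬ab (subst ABSet (find-∈ packedO o∈O v∈o) (proj₂ t)))) ⟨
    ∑ (λ v → χ o v * val v) ∎
    where
    open ≤-Reasoning
    -- Once (2, 0) and (1, 1) are excluded, the minimum 26 is attained at (1, 2).
    cases : ∀ x y → 4 ≤ 3 * x + y → (x ≡ 2 → y ≢ 0) → (x ≡ 1 → y ≢ 1) → 26 ≤ 10 * x + 8 * y
    cases 0 y 4≤y _ _ = ≤-trans (m≤m+n 26 6) (*-monoʳ-≤ 8 4≤y)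
    cases 1 0 (s≤s (s≤s (s≤s ()))) _ _
    cases 1 1 _ _ ¬11 = contradiction refl (¬11 refl)
    cases 1 (suc (suc y)) _ _ _ = +-monoʳ-≤ 10 (*-monoʳ-≤ 8 {2} (s≤s (s≤s z≤n)))
    cases 2 0 _ ¬20 _ = contradiction refl (¬20 refl)
    cases 2 (suc y) _ _ _ = ≤-trans (m≤m+n 26 2) (+-monoʳ-≤ 20 (*-monoʳ-≤ 8 {1} (s≤s z≤n)))
    cases (suc (suc (suc x))) y _ _ _ = ≤-trans (m≤m+n 26 4) (≤-trans (*-monoʳ-≤ 10 {3} {3 + x} (s≤s (s≤s (s≤s z≤n)))) (m≤m+n (10 * (3 + x)) _))

  earn-4set : ∀ {o} → o ∈ˡ O → ∣ o ∣ ≡ 4 → 26 ≤ ∑ (λ v → χ o v * val v)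
  earn-4set {o} o∈O o≡4 = case AASet? o of λ where
    (yes aao) → earn-AA o∈O aao
    (no ¬aa) → case ABSet? o of λ where
      (yes abo) → earn-AB o∈O abo
      (no ¬ab) → earn-other o∈O o≡4 ¬aa ¬ab

  val-covered : ∀ v → val v ≤ cnt P v * val v
  val-covered v with find-or P v
  ... | inj₁ (p∈P , v∈p) = ≤-trans (≤-reflexive (sym (*-identityˡ (val v)))) (*-monoˡ-≤ (val v) (∈⇒cnt>0 p∈P v∈p))
  ... | inj₂ p≡⊥ = ≤-trans (≤-reflexive (trans (val-free (no-a ∘ proj₁) (no-a ∘ proj₁)) (cong₂ (λ x y → 10 * x + 8 * y) a≡0 b≡0))) z≤n
    where
    p≡0 : ∣ p v ∣ ≡ 0
    p≡0 = trans (cong ∣_∣ p≡⊥) (∣⊥∣≡0 n)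
    a≡0 : a v ≡ 0
    a≡0 = cong (λ m → 𝟙 (m ≟ 4)) p≡0
    b≡0 : b v ≡ 0
    b≡0 = cong (λ m → 𝟙 (m ≟ 3)) p≡0
    no-a : a v ≢ 1
    no-a a≡1 = case trans (sym a≡1) a≡0 of λ ()

  need : ℕ → ℕ
  need m = 26 * 𝟙 (m ≟ 4) + 2 * 𝟙 (m ≟ 3)

  capacity : ℕ → ℕ
  capacity m = 48 * 𝟙 (m ≟ 4) + 24 * 𝟙 (m ≟ 3)

  need≤capacity : ∑ₗ (λ o → need ∣ o ∣) O ≤ ∑ₗ (λ S → capacity ∣ S ∣) P
  need≤capacity = begin
    ∑ₗ (λ o → need ∣ o ∣) O ≤⟨ ∑ₗ-mono O (λ {o} o∈O → earn o∈O ∣ o ∣ refl) ⟩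
    ∑ₗ (λ o → ∑ (λ v → χ o v * val v)) O ≡⟨ ∑ₗ-∑χ O val ⟩
    ∑ (λ v → cnt O v * val v) ≡⟨ sum-cong-≗ (λ v → trans (cong (_* val v) (once v)) (*-identityˡ (val v))) ⟩
    ∑ val ≤⟨ ∑-mono val-covered ⟩
    ∑ (λ v → cnt P v * val v) ≡⟨ ∑ₗ-∑χ P val ⟨
    ∑ₗ (λ S → ∑ (λ v → χ S v * val v)) P ≤⟨ ∑ₗ-mono P (λ S∈P → spend S∈P (size S∈P)) ⟩
    ∑ₗ (λ S → capacity ∣ S ∣) P ∎
    where
    open ≤-Reasoning
    earn : ∀ {o} → o ∈ˡ O → ∀ m → ∣ o ∣ ≡ m → need m ≤ ∑ (λ v → χ o v * val v)
    earn o∈O 0 _ = z≤n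
    earn o∈O 1 _ = z≤n
    earn o∈O 2 _ = z≤n
    earn o∈O 3 o≡3 = earn-3set o∈O o≡3
    earn o∈O 4 o≡4 = earn-4set o∈O o≡4
    earn o∈O (suc (suc (suc (suc (suc _))))) _ = z≤n
    spend : ∀ {S} → S ∈ˡ P → Size S → ∑ (λ v → χ S v * val v) ≤ capacity ∣ S ∣
    spend S∈P (four S≡4) = ≤-trans (charge-4set (S∈P , S≡4)) (≤-reflexive (cong capacity (sym S≡4)))
    spend S∈P (three S≡3) = ≤-trans (charge-3set S∈P S≡3) (≤-reflexive (cong capacity (sym S≡3)))

-- From the discharging bound to the ratio

-- Each element stays in the last set that contains it. Sets that become empty are retained, so the
-- length is that of the given cover.
disjointify : List (Subset n) → List (Subset n)
disjointify [] = []
disjointify (S ∷ C) = (S ─ ⋃ C) ∷ disjointify C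

length-disjointify : (C : List (Subset n)) → length (disjointify C) ≡ length C
length-disjointify [] = refl
length-disjointify (_ ∷ C) = cong suc (length-disjointify C)

cnt-disjointify : (C : List (Subset n)) (v : Fin n) → cnt (disjointify C) v ≡ χ (⋃ C) v
cnt-disjointify [] v = sym (χ-out {S = ⊥} {v} ∉⊥)
cnt-disjointify (S ∷ C) v = trans (cong (χ (S ─ ⋃ C) v +_) (cnt-disjointify C v)) (case v ∈? ⋃ C of λ where
    (yes v∈C) → trans (cong₂ _+_ (χ-out {S = S ─ ⋃ C} (λ v∈ → ∈─⇒∉ S (⋃ C) v∈ v∈C)) (χ-in v∈C))
                      (sym (χ-in {S = S ∪ ⋃ C} (x∈p∪q⁺ (inj₂ v∈C))))
    (no v∉C) → trans (cong (χ (S ─ ⋃ C) v +_) (χ-out v∉C)) (trans (+-identityʳ _) (case v ∈? S of λ where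
      (yes v∈S) → trans (χ-in (x∈p∧x∉q⇒x∈p─q v∈S v∉C)) (sym (χ-in {S = S ∪ ⋃ C} (x∈p∪q⁺ (inj₁ v∈S))))
      (no v∉S) → trans (χ-out {S = S ─ ⋃ C} (v∉S ∘ p─q⊆p S (⋃ C))) (sym (trans (χ-∪ʳ {S = S} v∉S) (χ-out v∉C))))))

covers⇒∈⋃ : {C : List (Subset n)} {v : Fin n} → Any (v ∈_) C → v ∈ ⋃ C
covers⇒∈⋃ (here v∈S) = x∈p∪q⁺ (inj₁ v∈S)
covers⇒∈⋃ (there v∈C) = x∈p∪q⁺ (inj₂ (covers⇒∈⋃ v∈C))

disjointify-available : (I : Instance n) {C : List (Subset n)} → All (_∈ˡ family I) C →
                        All (λ o → ∣ o ∣ ≤ 4 × (Nonempty o → Available I o)) (disjointify C)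
disjointify-available I [] = []
disjointify-available I {S ∷ C} (S∈ ∷ C∈) =
  (≤-trans (∣p─q∣≤∣p∣ S (⋃ C)) (proj₂ (All.lookup (sizes I) S∈)) , λ ne → ne , contained S∈) ∷ disjointify-available I C∈
  where
  contained : ∀ {F} → S ∈ˡ F → Any ((S ─ ⋃ C) ⊆_) F
  contained (here refl) = here (p─q⊆p S (⋃ C))
  contained (there S∈F) = there (contained S∈F)

-- The margin by which 35 + 6 * weight m exceeds 12 * m.
slack : ℕ → ℕ
slack 0 = 35
slack 1 = 23
slack 2 = 11
slack 3 = 5
slack _ = 11

slack-eq : ∀ m → m ≤ 4 → 12 * m + slack m ≡ 35 + 6 * weight m
slack-eq 0 _ = refl
slack-eq 1 _ = refl
slack-eq 2 _ = refl
slack-eq 3 _ = refl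
slack-eq 4 _ = refl
slack-eq (suc (suc (suc (suc (suc _))))) (s≤s (s≤s (s≤s (s≤s ()))))

slack≥5 : ∀ m → 5 ≤ slack m
slack≥5 0 = m≤m+n 5 30
slack≥5 1 = m≤m+n 5 18
slack≥5 2 = m≤m+n 5 6
slack≥5 3 = ≤-refl
slack≥5 (suc (suc (suc (suc _)))) = m≤m+n 5 6

slack≥11 : ∀ m → m ≢ 3 → 11 ≤ slack m
slack≥11 0 _ = m≤m+n 11 24
slack≥11 1 _ = m≤m+n 11 12
slack≥11 2 _ = ≤-refl
slack≥11 3 3≢3 = contradiction refl 3≢3
slack≥11 (suc (suc (suc (suc _)))) _ = ≤-refl

even-total⇒triple : ∀ h x₄ x₃ t → 2 * h ≡ 4 * x₄ + 3 * x₃ + 2 * t + 1 → 1 ≤ x₃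
even-total⇒triple h x₄ zero t eq = contradiction (trans eq (lemma x₄ t)) (even≢odd h (2 * x₄ + t))
  where lemma : ∀ x t → 4 * x + 0 + 2 * t + 1 ≡ suc (2 * (2 * x + t))
        lemma = solve-∀
even-total⇒triple h x₄ (suc x₃) t eq = s≤s z≤n

-- When the search is able to exchange the whole solution, the possible 1-set
-- is paid for by the slack of the optimum or by the 3-sets of the solution.
parity-paid : (D : List (Subset n)) (x₄ x₃ t : ℕ) → All (λ o → ∣ o ∣ ≤ 4) D →
              ∑ₗ ∣_∣ D ≡ 4 * x₄ + 3 * x₃ + 2 * t + 1 → ∑ₗ (λ o → weight ∣ o ∣) D ≤ 4 * x₄ + x₃ →
              12 ≤ 6 * x₃ + ∑ₗ (λ o → slack ∣ o ∣) D
parity-paid [] x₄ x₃ t _ eq _ = case trans eq (+-comm _ 1) of λ ()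
parity-paid (o ∷ []) x₄ x₃ t (o≤4 ∷ []) eq w = ≤-trans
    (single ∣ o ∣ o≤4 (trans (sym (+-identityʳ _)) eq) (≤-trans (≤-reflexive (sym (+-identityʳ _))) w))
    (+-monoʳ-≤ (6 * x₃) (m≤m+n _ 0))
  where
  single : ∀ m → m ≤ 4 → m ≡ 4 * x₄ + 3 * x₃ + 2 * t + 1 → weight m ≤ 4 * x₄ + x₃ → 12 ≤ 6 * x₃ + slack m
  single 0 _ _ _ = ≤-trans (m≤m+n 12 23) (m≤n+m 35 (6 * x₃))
  single 1 _ _ _ = ≤-trans (m≤m+n 12 11) (m≤n+m 23 (6 * x₃))
  single 2 _ eq _ = ≤-trans (m≤m+n 12 5) (+-monoˡ-≤ 11 (*-monoʳ-≤ 6 (even-total⇒triple 1 x₄ x₃ t eq)))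
  -- The size equation leaves no room for a set in `P`, whereas the 3-set of `D` has weight 1.
  single 3 _ eq w = absurd w (exceeds x₄ x₃ eq)
    where
    exceeds : ∀ x y → 3 ≡ 4 * x + 3 * y + 2 * t + 1 → 4 * x + y < 1
    exceeds zero zero _ = s≤s z≤n
    exceeds zero (suc y) e = absurd (+-monoˡ-≤ 1 (≤-trans (*-monoʳ-≤ 3 {1} {suc y} (s≤s z≤n)) (m≤m+n _ (2 * t)))) (≤-reflexive (cong suc (sym e)))
    exceeds (suc x) y e = absurd (≤-trans (+-monoˡ-≤ 1 (≤-trans (*-monoʳ-≤ 4 {1} {suc x} (s≤s z≤n)) (≤-trans (m≤m+n _ (3 * y)) (m≤m+n _ (2 * t))))) (≤-reflexive (sym e))) (n≤1+n 4)
  single 4 _ eq _ = ≤-trans (m≤m+n 12 5) (+-monoˡ-≤ 11 (*-monoʳ-≤ 6 (even-total⇒triple 2 x₄ x₃ t eq)))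
  single (suc (suc (suc (suc (suc _))))) (s≤s (s≤s (s≤s (s≤s ())))) _ _
parity-paid (o ∷ o′ ∷ []) x₄ x₃ t _ eq _ = case ∣ o ∣ ≟ 3 of λ where
  (no o≢3) → ≤-trans (≤-trans (m≤m+n 12 4) (+-mono-≤ (slack≥11 ∣ o ∣ o≢3) (+-monoˡ-≤ 0 (slack≥5 ∣ o′ ∣)))) (m≤n+m _ (6 * x₃))
  (yes o≡3) → case ∣ o′ ∣ ≟ 3 of λ where
    (no o′≢3) → ≤-trans (≤-trans (m≤m+n 12 4) (+-mono-≤ (slack≥5 ∣ o ∣) (+-monoˡ-≤ 0 (slack≥11 ∣ o′ ∣ o′≢3)))) (m≤n+m _ (6 * x₃))
    (yes o′≡3) → ≤-trans (m≤m+n 12 4) (+-mono-≤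
      (*-monoʳ-≤ 6 (even-total⇒triple 3 x₄ x₃ t (trans (sym (cong₂ (λ x y → x + (y + 0)) o≡3 o′≡3)) eq)))
      (+-mono-≤ (slack≥5 ∣ o ∣) (+-monoˡ-≤ 0 (slack≥5 ∣ o′ ∣))))
-- Three sets have slack 5 each, which is more than 12.
parity-paid (o ∷ o′ ∷ o″ ∷ D) x₄ x₃ t _ _ _ = ≤-trans (≤-trans (m≤m+n 12 3)
  (+-mono-≤ (slack≥5 ∣ o ∣) (+-mono-≤ (slack≥5 ∣ o′ ∣) (≤-trans (slack≥5 ∣ o″ ∣) (m≤m+n _ _))))) (m≤n+m _ (6 * x₃))

-- Counting elements gives 48c = 24n - 48a - 24b + 24u. The subtracted terms are the capacities 48
-- and 24, and `24 * u` is halved to the 12.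
combine-local : ∀ a b t u l N {n c} → n ≡ 4 * a + 3 * b + 2 * t + u → c ≡ a + b + t + u →
                24 * n ≤ l * 70 + N → N ≤ 48 * a + 24 * b → u ≤ 1 → 24 * c ≤ 35 * l + 12
combine-local a b t u l N refl refl n≤ N≤ u≤1 =
  *-cancelˡ-≤ 2 (≤-from (+-mono-≤ (+-mono-≤ n≤ N≤) (*-monoʳ-≤ 24 u≤1)) (lemma a b t u l N))
  where
  lemma : ∀ a b t u l N → 2 * (24 * (a + b + t + u)) + (l * 70 + N + (48 * a + 24 * b) + 24 * 1)
                        ≡ 2 * (35 * l + 12) + (24 * (4 * a + 3 * b + 2 * t + u) + N + 24 * u)
  lemma = solve-∀

-- Here 24c = 12n - 24a - 12b + 12u, while six times the objective is 24a + 6b; the remaining 6b and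
-- the slack `s` pay for the 1-set.
combine-global : ∀ a b t u l W s {n c} → n ≡ 4 * a + 3 * b + 2 * t + u → c ≡ a + b + t + u →
                 12 * n + s ≡ l * 35 + 6 * W → W ≤ 4 * a + b → 12 * u ≤ 6 * b + s → 24 * c ≤ 35 * l
combine-global a b t u l W s refl refl n≡ W≤ u≤ =
  ≤-from (+-mono-≤ (+-mono-≤ (≤-reflexive n≡) (*-monoʳ-≤ 6 W≤)) u≤) (lemma a b t u l W s)
  where
  lemma : ∀ a b t u l W s → 24 * (a + b + t + u) + (l * 35 + 6 * W + 6 * (4 * a + b) + (6 * b + s))
                          ≡ 35 * l + (12 * (4 * a + 3 * b + 2 * t + u) + s + 6 * W + 12 * u)
  lemma = solve-∀

module Ratio {n : ℕ} (I : Instance n) (k : ℕ) (P : List (Subset n)) (packP : Packing I P)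
  (opt : LocalOptimum I k P) (100≤k : 100 ≤ k) (D : List (Subset n)) (once : ∀ v → cnt D v ≡ 1)
  (allD : All (λ o → ∣ o ∣ ≤ 4 × (Nonempty o → Available I o)) D) (twos ones : List (Subset n))
  (twos≡2 : All (λ s → ∣ s ∣ ≡ 2) twos) (ones≡1 : All (λ s → ∣ s ∣ ≡ 1) ones)
  (ones≤1 : length ones ≤ 1) (partition : ∀ v → cnt (P ++ twos ++ ones) v ≡ 1) where

  open Charging I k P packP opt 100≤k D once allD using (need; capacity; need≤capacity)

  x₄ x₃ t u l c : ℕ
  x₄ = X 4 P
  x₃ = X 3 P
  t = length twos
  u = length ones
  l = length D
  c = length (P ++ twos ++ ones)

  by-size : (f : ℕ → ℕ) → ∑ₗ (λ S → f ∣ S ∣) P ≡ f 4 * x₄ + f 3 * x₃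
  by-size f = trans (∑ₗ-cong P (λ {S} S∈P → let _ , 3≤ , ≤4 = All.lookup (proj₁ packP) S∈P in split ∣ S ∣ 3≤ ≤4))
    (trans (∑ₗ-distrib-+ (λ S → f 4 * 𝟙 (∣ S ∣ ≟ 4)) _ P)
      (cong₂ _+_ (trans (∑ₗ-distribˡ-* (f 4) _ P) (cong (f 4 *_) (sym (X≡∑ₗ 4 P))))
                 (trans (∑ₗ-distribˡ-* (f 3) _ P) (cong (f 3 *_) (sym (X≡∑ₗ 3 P))))))
    where
    split : ∀ m → 3 ≤ m → m ≤ 4 → f m ≡ f 4 * 𝟙 (m ≟ 4) + f 3 * 𝟙 (m ≟ 3)
    split 3 _ _ = trans (sym (*-identityʳ (f 3))) (cong (_+ f 3 * 1) (sym (*-zeroʳ (f 4))))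
    split 4 _ _ = trans (sym (*-identityʳ (f 4))) (trans (sym (+-identityʳ _)) (cong (_+_ (f 4 * 1)) (sym (*-zeroʳ (f 3)))))
    split 0 () _
    split 1 (s≤s ()) _
    split 2 (s≤s (s≤s ())) _
    split (suc (suc (suc (suc (suc _))))) _ (s≤s (s≤s (s≤s (s≤s ()))))

  ∑-length : (E : List (Subset n)) → ∑ₗ (λ _ → 1) E ≡ length E
  ∑-length E = trans (∑ₗ-const 1 E) (*-identityʳ _)

  c≡ : c ≡ x₄ + x₃ + t + u
  c≡ = trans (length-++ P) (trans (cong₂ _+_
      (trans (sym (∑-length P)) (trans (by-size (λ _ → 1)) (cong₂ _+_ (*-identityˡ x₄) (*-identityˡ x₃))))
      (length-++ twos)) (sym (+-assoc (x₄ + x₃) t u)))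

  n≡ : n ≡ 4 * x₄ + 3 * x₃ + 2 * t + u
  n≡ = trans (sym (partition-size {C = P ++ twos ++ ones} partition)) (trans (∑ₗ-++ ∣_∣ P (twos ++ ones)) (trans
    (cong₂ _+_ (by-size id) (trans (∑ₗ-++ ∣_∣ twos ones) (cong₂ _+_
      (trans (∑ₗ-cong twos (All.lookup twos≡2)) (trans (∑ₗ-const 2 twos) (*-comm t 2)))
      (trans (∑ₗ-cong ones (All.lookup ones≡1)) (∑-length ones)))))
    (sym (+-assoc (4 * x₄ + 3 * x₃) (2 * t) u))))

  ∑D≡n : ∑ₗ ∣_∣ D ≡ n
  ∑D≡n = partition-size {C = D} once

  ratio-local : 24 * c ≤ 35 * l + 12
  ratio-local = combine-local x₄ x₃ t u l (∑ₗ (λ o → need ∣ o ∣) D) n≡ c≡ (begin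
      24 * n ≡⟨ cong (24 *_) ∑D≡n ⟨
      24 * ∑ₗ ∣_∣ D ≡⟨ ∑ₗ-distribˡ-* 24 ∣_∣ D ⟨
      ∑ₗ (λ o → 24 * ∣ o ∣) D ≤⟨ ∑ₗ-mono D (λ {o} o∈D → per-size ∣ o ∣ (proj₁ (All.lookup allD o∈D))) ⟩
      ∑ₗ (λ o → 70 + need ∣ o ∣) D ≡⟨ ∑ₗ-distrib-+ (λ _ → 70) _ D ⟩
      ∑ₗ (λ _ → 70) D + ∑ₗ (λ o → need ∣ o ∣) D ≡⟨ cong (_+ ∑ₗ (λ o → need ∣ o ∣) D) (∑ₗ-const 70 D) ⟩
      l * 70 + ∑ₗ (λ o → need ∣ o ∣) D ∎)
    (≤-trans need≤capacity (≤-reflexive (by-size capacity))) ones≤1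
    where
    open ≤-Reasoning
    -- Tight for sizes 3 and 4, which fixes the constants 2 and 26 in `need`.
    per-size : ∀ m → m ≤ 4 → 24 * m ≤ 70 + need m
    per-size 0 _ = z≤n
    per-size 1 _ = m≤m+n 24 46
    per-size 2 _ = m≤m+n 48 22
    per-size 3 _ = ≤-refl
    per-size 4 _ = ≤-refl
    per-size (suc (suc (suc (suc (suc _))))) (s≤s (s≤s (s≤s (s≤s ()))))

  -- All of `P` may be removed in one step, so a local optimum has at least the objective of the 3-
  -- and 4-sets of `D`.
  ratio-global : length P ≤ k → 24 * c ≤ 35 * l
  ratio-global P≤k = combine-global x₄ x₃ t u l (∑ₗ (λ o → weight ∣ o ∣) D) (∑ₗ (λ o → slack ∣ o ∣) D) n≡ c≡ margins optimal (paid u refl)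
    where
    open ≤-Reasoning
    E : List (Subset n)
    E = bigSets D
    packE : Packing I E
    packE = All.tabulate (λ {o} o∈E → let o∈D , 3≤o = ∈-filter⁻ (λ s → 3 ≤? ∣ s ∣) {xs = D} o∈E ; o≤4 , avail = All.lookup allD o∈D in
        avail (∣∣>0⇒nonempty o (≤-trans (s≤s z≤n) 3≤o)) , 3≤o , o≤4) ,
      packed⇒disjoint (packed λ v → ≤-trans (m≤m+n _ _) (≤-reflexive (trans (sym (∑ₗ-filter (λ s → 3 ≤? ∣ s ∣) (λ S → χ S v) D)) (once v))))
    optimal : ∑ₗ (λ o → weight ∣ o ∣) D ≤ 4 * x₄ + x₃
    optimal = begin
      ∑ₗ (λ o → weight ∣ o ∣) D ≡⟨ ∑weight-filter D ⟨
      ∑ₗ (λ o → weight ∣ o ∣) E ≤⟨ m≤m+n _ _ ⟩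
      ∑ₗ (λ o → weight ∣ o ∣) E + ∑ₗ (λ S → weight ∣ S ─ ⋃ E ∣) (touched I E P)
        ≤⟨ exchange I opt packP packE (≤-trans (length-filter (touches? (⋃ E)) P) P≤k) ⟩
      ∑ₗ (λ S → weight ∣ S ∣) (touched I E P) ≤⟨ m≤m+n _ _ ⟩
      ∑ₗ (λ S → weight ∣ S ∣) (touched I E P) + ∑ₗ (λ S → weight ∣ S ∣) (filter (¬? ∘ touches? (⋃ E)) P)
        ≡⟨ ∑ₗ-filter (touches? (⋃ E)) _ P ⟨
      ∑ₗ (λ S → weight ∣ S ∣) P ≡⟨ objective≡∑ₗ P ⟨
      4 * x₄ + x₃ ∎
    margins : 12 * n + ∑ₗ (λ o → slack ∣ o ∣) D ≡ l * 35 + 6 * ∑ₗ (λ o → weight ∣ o ∣) D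
    margins = begin-equality
      12 * n + ∑ₗ (λ o → slack ∣ o ∣) D ≡⟨ cong (λ m → 12 * m + ∑ₗ (λ o → slack ∣ o ∣) D) ∑D≡n ⟨
      12 * ∑ₗ ∣_∣ D + ∑ₗ (λ o → slack ∣ o ∣) D ≡⟨ cong (_+ ∑ₗ (λ o → slack ∣ o ∣) D) (∑ₗ-distribˡ-* 12 ∣_∣ D) ⟨
      ∑ₗ (λ o → 12 * ∣ o ∣) D + ∑ₗ (λ o → slack ∣ o ∣) D ≡⟨ ∑ₗ-distrib-+ (λ o → 12 * ∣ o ∣) _ D ⟨
      ∑ₗ (λ o → 12 * ∣ o ∣ + slack ∣ o ∣) D ≡⟨ ∑ₗ-cong D (λ {o} o∈D → slack-eq ∣ o ∣ (proj₁ (All.lookup allD o∈D))) ⟩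
      ∑ₗ (λ o → 35 + 6 * weight ∣ o ∣) D ≡⟨ ∑ₗ-distrib-+ (λ _ → 35) _ D ⟩
      ∑ₗ (λ _ → 35) D + ∑ₗ (λ o → 6 * weight ∣ o ∣) D ≡⟨ cong₂ _+_ (∑ₗ-const 35 D) (∑ₗ-distribˡ-* 6 _ D) ⟩
      l * 35 + 6 * ∑ₗ (λ o → weight ∣ o ∣) D ∎
    paid : ∀ m → u ≡ m → 12 * u ≤ 6 * x₃ + ∑ₗ (λ o → slack ∣ o ∣) D
    paid 0 u≡0 = ≤-trans (≤-reflexive (cong (12 *_) u≡0)) z≤n
    paid 1 u≡1 = ≤-trans (≤-reflexive (cong (12 *_) u≡1)) (parity-paid D x₄ x₃ t (All.map proj₁ allD)
      (trans ∑D≡n (trans n≡ (cong (4 * x₄ + 3 * x₃ + 2 * t +_) u≡1))) optimal)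
    paid (suc (suc m)) u≡ = absurd ones≤1 (≤-trans (s≤s (s≤s z≤n)) (≤-reflexive (sym u≡)))

  3P≤4l : length P * 3 ≤ l * 4
  3P≤4l = begin
    length P * 3 ≡⟨ ∑ₗ-const 3 P ⟨
    ∑ₗ (λ _ → 3) P ≤⟨ ∑ₗ-mono P (λ S∈P → proj₁ (proj₂ (All.lookup (proj₁ packP) S∈P))) ⟩
    ∑ₗ ∣_∣ P ≤⟨ packed-size (packing⇒packed I packP) ⟩
    n ≡⟨ ∑D≡n ⟨
    ∑ₗ ∣_∣ D ≤⟨ ∑ₗ-mono D (λ o∈D → proj₁ (All.lookup allD o∈D)) ⟩
    ∑ₗ (λ _ → 4) D ≡⟨ ∑ₗ-const 4 D ⟩
    l * 4 ∎
    where open ≤-Reasoning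

  -- Here `d` stands for the denominator of ε, so the error term is `24 * l` divided by `d`. If `P`
  -- has more than `k` sets, then 3d ≤ 4l because these sets are disjoint, and 12d ≤ 16l absorbs the
  -- 12.
  ratio : ∀ d → d ≤ k → 24 * c * d ≤ 35 * l * d + 24 * l
  ratio d d≤k = case length P ≤? k of λ where
      (yes P≤k) → ≤-trans (*-monoˡ-≤ d (ratio-global P≤k)) (m≤m+n _ _)
      (no P≰k) → ≤-trans (*-monoˡ-≤ d ratio-local) (≤-trans (≤-reflexive (*-distribʳ-+ d (35 * l) 12))
        (+-monoʳ-≤ (35 * l * d) (begin
          12 * d ≡⟨ lemma d ⟩
          4 * (d * 3) ≤⟨ *-monoʳ-≤ 4 (≤-trans (*-monoˡ-≤ 3 (≤-trans d≤k (<⇒≤ (≰⇒> P≰k)))) 3P≤4l) ⟩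
          4 * (l * 4) ≡⟨ lemma′ l ⟩
          16 * l ≤⟨ *-monoˡ-≤ l (m≤m+n 16 8) ⟩
          24 * l ∎)))
    where
    open ≤-Reasoning
    lemma : ∀ d → 12 * d ≡ 4 * (d * 3)
    lemma = solve-∀
    lemma′ : ∀ l → 4 * (l * 4) ≡ 16 * l
    lemma′ = solve-∀

-- Translation to rational numbers

open import Data.Integer as ℤ using (ℤ; +_; -[1+_])
import Data.Integer.Properties as ℤ
open import Data.Rational as ℚ using (ℚ; mkℚ; 0ℚ; _/_) renaming (_<_ to _<ℚ_; _+_ to _+ℚ_)
import Data.Rational.Properties as ℚ
open import Data.Rational.Unnormalised as ℚᵘ using (mkℚᵘ)
import Data.Rational.Unnormalised.Properties as ℚᵘ

fromℕ≃ : ∀ m → ℚ.toℚᵘ (fromℕ m) ℚᵘ.≃ mkℚᵘ (+ m) 0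
fromℕ≃ m = ℚ.toℚᵘ-fromℚᵘ (mkℚᵘ (+ m) 0)

-- A positive rational is at least one over its denominator; the larger part of its numerator, `a`,
-- is given away.
ratio-bound : ∀ c l (ε : ℚ) → 0ℚ <ℚ ε → 24 * c * ℚ.↧ₙ ε ≤ 35 * l * ℚ.↧ₙ ε + 24 * l →
              fromℕ c ℚ.≤ (+ 35 / 24 +ℚ ε) ℚ.* fromℕ l
ratio-bound _ _ (mkℚ (+ 0) d _) (ℚ.*<* (ℤ.+<+ ())) _
ratio-bound _ _ (mkℚ -[1+ a ] d _) (ℚ.*<* ()) _
ratio-bound c l ε@(mkℚ (+ suc a) d _) _ bound = ℚ.toℚᵘ-cancel-≤ (begin
  ℚ.toℚᵘ (fromℕ c) ≃⟨ fromℕ≃ c ⟩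
  mkℚᵘ (+ c) 0 ≤⟨ ℚᵘ.*≤* (subst₂ ℤ._≤_ left right (ℤ.+≤+ naturals)) ⟩
  (mkℚᵘ (+ 35) 23 ℚᵘ.+ mkℚᵘ (+ suc a) d) ℚᵘ.* mkℚᵘ (+ l) 0
    ≃⟨ ℚᵘ.*-cong (ℚ.toℚᵘ-homo-+ (+ 35 / 24) ε) (fromℕ≃ l) ⟨
  ℚ.toℚᵘ (+ 35 / 24 +ℚ ε) ℚᵘ.* ℚ.toℚᵘ (fromℕ l) ≃⟨ ℚ.toℚᵘ-homo-* (+ 35 / 24 +ℚ ε) (fromℕ l) ⟨
  ℚ.toℚᵘ ((+ 35 / 24 +ℚ ε) ℚ.* fromℕ l) ∎)
  where
  open ℚᵘ.≤-Reasoning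
  left : + (c * (24 * suc d * 1)) ≡ + c ℤ.* + (24 * suc d * 1)
  left = ℤ.pos-* c _
  right : + ((35 * suc d + suc a * 24) * l * 1) ≡ (+ 35 ℤ.* + suc d ℤ.+ + suc a ℤ.* + 24) ℤ.* + l ℤ.* + 1
  right = trans (ℤ.pos-* ((35 * suc d + suc a * 24) * l) 1) (cong (ℤ._* + 1) (ℤ.pos-* (35 * suc d + suc a * 24) l))
  naturals : c * (24 * suc d * 1) ≤ (35 * suc d + suc a * 24) * l * 1
  naturals = ≤-trans (≤-reflexive (lemma c (suc d))) (≤-trans bound
    (≤-trans (+-monoʳ-≤ (35 * l * suc d) (m≤m+n (24 * l) (a * (24 * l)))) (≤-reflexive (lemma′ l (suc d) a))))
    where
    lemma : ∀ c d → c * (24 * d * 1) ≡ 24 * c * d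
    lemma = solve-∀
    lemma′ : ∀ l d a → 35 * l * d + (24 * l + a * (24 * l)) ≡ (35 * d + (1 + a) * 24) * l * 1
    lemma′ = solve-∀

theorem3p3 : ∀ (ε : ℚ) → 0ℚ <ℚ ε →
    ∃[ k₀ ] (∀ (k : ℕ) → 100 ≤ k → k₀ ≤ k →
    A2IsApproximation k (+ 35 / 24 +ℚ ε))
-- The threshold `k₀` is the denominator of ε, as required by `ratio`.
theorem3p3 ε ε>0 = ℚ.↧ₙ ε , λ k 100≤k ε≤k n I S feasible →
  A2-terminates I k feasible , λ where
    C (P , S⇝P , opt , compl@(twos , ones , refl , twos≡2 , ones≡1 , ones≤1 , C# , covers)) →
      let packP = search-packing I (bigSets-packing I feasible) S⇝P
          partition : ∀ v → cnt C v ≡ 1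
          partition v = ≤-antisym (disjoint⇒packed C# .atMostOnce v)
            (≤-trans (≤-reflexive (sym (χ-in (covers⇒∈⋃ (covers v))))) (≤-reflexive (χ-⋃ (disjoint⇒packed C#) v)))
      in completes-feasible I feasible packP compl , λ O ((O⊆ , coverO) , _) →
        let once : ∀ v → cnt (disjointify O) v ≡ 1
            once v = trans (cnt-disjointify O v) (χ-in (covers⇒∈⋃ (coverO v)))
        in ratio-bound (length C) (length O) ε ε>0 (subst (λ l → 24 * length C * ℚ.↧ₙ ε ≤ 35 * l * ℚ.↧ₙ ε + 24 * l) (length-disjointify O)
             (Ratio.ratio I k P packP opt 100≤k (disjointify O) once (disjointify-available I O⊆)
               twos ones twos≡2 ones≡1 ones≤1 partition (ℚ.↧ₙ ε) ε≤k))
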